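{- (1) ${}^\perp\mathbb{Q}$ is the class of all abelian groups. (2) ${}^\perp(\mathbb{Z}^\omega/\mathbb{Z}^{(\omega)})=\bigcap_{p\in P}{}^\perp J_p$, where $P$ is the set of all primes. (3) For every cardinal $\kappa$, ${}^\perp(\mathbb{Z}^\kappa/B^{<\infty})={}^\perp\mathbb{Q}$, where $B^{<\infty}$ is the subgroup of $\mathbb{Z}^\kappa$ consisting of the bounded functions.
   Context: All groups are abelian. For a group $X$, ${}^\perp X$ denotes the class of all abelian groups $G$ with $\mathrm{Ext}(G,X)=0$. $\mathbb{Z}^\omega$ is the direct product and $\mathbb{Z}^{(\omega)}$ the direct sum of countably many copies of $\mathbb{Z}$. $J_p$ is the group of $p$-adic integers. Elements of $\mathbb{Z}^\kappa$ are functions $\kappa\to\mathbb{Z}$. -}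

module Defs where

open import Algebra.Bundles using (AbelianGroup)
import Algebra.Construct.DirectProduct as DirectProduct
import Algebra.Construct.Pointwise as Pointwise
import Algebra.Morphism.Construct.Composition as Composition
import Algebra.Morphism.Construct.Identity as Identity
open import Algebra.Morphism.Structures using (module GroupMorphisms)
import Algebra.Properties.AbelianGroup as AbelianGroupProperties
import Algebra.Properties.CommutativeSemigroup as CommutativeSemigroupProperties
open import Data.Integer.Base as ℤ using (ℤ; +_; ∣_∣)
import Data.Integer.Divisibility.Signed as ℤ
import Data.Integer.Properties as ℤ
open import Data.Integer.Tactic.RingSolver using (solve-∀)
open import Data.List.Base using (List; []; _++_)
open import Data.List.Membership.Propositional using (_∉_)
open import Data.List.Membership.Propositional.Properties using (∈-++⁺ˡ; ∈-++⁺ʳ)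
open import Data.Nat.Base as ℕ using (ℕ; suc)
import Data.Nat.Divisibility as ℕ
import Data.Nat.Properties as ℕ
open import Data.Product.Base using (∃-syntax; Σ; _,_; proj₁; proj₂)
import Data.Rational.Properties as ℚ
open import Function.Base using (_∘_; id)
open import Function.Bundles using (Func; Surjection; _⇔_; mk⇔)
open import Function.Definitions using (Surjective)
open import Level using (Level; _⊔_; 0ℓ) renaming (suc to lsuc)
open import Relation.Binary.Bundles using (Setoid)
open import Relation.Binary.PropositionalEquality as ≡ using (_≡_)
import Relation.Binary.Reasoning.Setoid as SetoidReasoning
open import Relation.Unary using (Pred)

private
  variable
    a b c d p : Level

-- The axiom of choice: every surjection of setoids has a section.
-- The section must respect the equalities; this is what distinguishes the
-- axiom from the trivially provable choice principle for Σ-types, and what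
-- makes it imply excluded middle (Diaconescu).
AxiomOfChoice : ∀ a b c d → Set (lsuc (a ⊔ b ⊔ c ⊔ d))
AxiomOfChoice a b c d =
  {A : Setoid a b} {B : Setoid c d} (f : Surjection A B) →
  Σ (Func B A) λ s → ∀ y → Setoid._≈_ B (Surjection.to f (Func.to s y)) y

record Subgroup (A : AbelianGroup a b) (p : Level) : Set (a ⊔ b ⊔ lsuc p) where
  open AbelianGroup A
  field
    member    : Pred Carrier p
    resp      : ∀ {x y} → x ≈ y → member x → member y
    ε-closed  : member ε
    ∙-closed  : ∀ {x y} → member x → member y → member (x ∙ y)
    ⁻¹-closed : ∀ {x} → member x → member (x ⁻¹)

⌊_⌋ : {A : AbelianGroup a b} → Subgroup A p → AbelianGroup (a ⊔ p) b
⌊_⌋ {A = A} S = record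
  { Carrier = Σ Carrier member
  ; _≈_     = λ x y → proj₁ x ≈ proj₁ y
  ; _∙_     = λ (x , x∈) (y , y∈) → x ∙ y , ∙-closed x∈ y∈
  ; ε       = ε , ε-closed
  ; _⁻¹     = λ (x , x∈) → x ⁻¹ , ⁻¹-closed x∈
  ; isAbelianGroup = record
    { isGroup = record
      { isMonoid = record
        { isSemigroup = record
          { isMagma = record
            { isEquivalence = record { refl = refl ; sym = sym ; trans = trans }
            ; ∙-cong = ∙-cong
            }
          ; assoc = λ x y z → assoc (proj₁ x) (proj₁ y) (proj₁ z)
          }
        ; identity = identityˡ ∘ proj₁ , identityʳ ∘ proj₁
        }
      ; inverse = inverseˡ ∘ proj₁ , inverseʳ ∘ proj₁
      ; ⁻¹-cong = ⁻¹-cong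
      }
    ; comm = λ x y → comm (proj₁ x) (proj₁ y)
    }
  }
  where
  open AbelianGroup A
  open Subgroup S

infixl 7 _/_

_/_ : (A : AbelianGroup a b) → Subgroup A p → AbelianGroup a p
A / N = record
  { Carrier = Carrier
  ; _≈_     = λ x y → member (x ∙ y ⁻¹)
  ; _∙_     = _∙_
  ; ε       = ε
  ; _⁻¹     = _⁻¹
  ; isAbelianGroup = record
    { isGroup = record
      { isMonoid = record
        { isSemigroup = record
          { isMagma = record
            { isEquivalence = record
              { refl  = ≈⇒∼ refl
              ; sym   = λ {x} {y} x∼y → resp (⁻¹-anti-homo-// x y) (⁻¹-closed x∼y)
              ; trans = λ {x} {y} {z} x∼y y∼z → resp (telescope x y z) (∙-closed x∼y y∼z)
              }
            ; ∙-cong = λ {x} {y} {u} {v} x∼y u∼v → resp (shuffle x y u v) (∙-closed x∼y u∼v)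
            }
          ; assoc = λ x y z → ≈⇒∼ (assoc x y z)
          }
        ; identity = (λ x → ≈⇒∼ (identityˡ x)) , (λ x → ≈⇒∼ (identityʳ x))
        }
      ; inverse = (λ x → ≈⇒∼ (inverseˡ x)) , (λ x → ≈⇒∼ (inverseʳ x))
      ; ⁻¹-cong = λ {x} {y} x∼y → resp (sym (⁻¹-∙-comm x (y ⁻¹))) (⁻¹-closed x∼y)
      }
    ; comm = λ x y → ≈⇒∼ (comm x y)
    }
  }
  where
  open AbelianGroup A
  open Subgroup N
  open AbelianGroupProperties A
  open CommutativeSemigroupProperties commutativeSemigroup using (interchange)
  open SetoidReasoning setoid

  ≈⇒∼ : ∀ {x y} → x ≈ y → member (x ∙ y ⁻¹)
  ≈⇒∼ {x} {y} x≈y = resp (sym (trans (∙-congʳ x≈y) (inverseʳ y))) ε-closed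

  telescope : ∀ x y z → (x ∙ y ⁻¹) ∙ (y ∙ z ⁻¹) ≈ x ∙ z ⁻¹
  telescope x y z = begin
    (x ∙ y ⁻¹) ∙ (y ∙ z ⁻¹)  ≈⟨ assoc x (y ⁻¹) (y ∙ z ⁻¹) ⟩
    x ∙ (y ⁻¹ ∙ (y ∙ z ⁻¹))  ≈⟨ ∙-congˡ (sym (assoc (y ⁻¹) y (z ⁻¹))) ⟩
    x ∙ ((y ⁻¹ ∙ y) ∙ z ⁻¹)  ≈⟨ ∙-congˡ (trans (∙-congʳ (inverseˡ y)) (identityˡ (z ⁻¹))) ⟩
    x ∙ z ⁻¹                 ∎

  shuffle : ∀ x y u v → (x ∙ y ⁻¹) ∙ (u ∙ v ⁻¹) ≈ (x ∙ u) ∙ (y ∙ v) ⁻¹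
  shuffle x y u v = trans (interchange x (y ⁻¹) u (v ⁻¹)) (∙-congˡ (⁻¹-∙-comm y v))

module _ (G : AbelianGroup a b) (X : AbelianGroup c d) where
  private
    module G = AbelianGroup G
    module X = AbelianGroup X

  -- Short exact sequences 0 → X → E → G → 0.  No generality is lost by the
  -- bound on the size of E: its underlying set is in bijection with X × G.
  record Extension : Set (lsuc (a ⊔ b ⊔ c ⊔ d)) where
    field
      E : AbelianGroup (c ⊔ a) (d ⊔ b)
    module E = AbelianGroup E
    field
      ι             : X.Carrier → E.Carrier
      π             : E.Carrier → G.Carrier
      ι-mono        : GroupMorphisms.IsGroupMonomorphism X.rawGroup E.rawGroup ι
      π-homo        : GroupMorphisms.IsGroupHomomorphism E.rawGroup G.rawGroup π
      π-surjective  : Surjective E._≈_ G._≈_ π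
      exact         : ∀ e → π e G.≈ G.ε ⇔ (∃[ x ] ι x E.≈ e)

  record _≅_ (S T : Extension) : Set (a ⊔ b ⊔ c ⊔ d) where
    private
      module S = Extension S
      module T = Extension T
    field
      to      : S.E.Carrier → T.E.Carrier
      to-iso  : GroupMorphisms.IsGroupIsomorphism S.E.rawGroup T.E.rawGroup to
      to-ι    : ∀ x → to (S.ι x) T.E.≈ T.ι x
      π-to    : ∀ e → T.π (to e) G.≈ S.π e

  private
    ≅-refl : ∀ {S} → S ≅ S
    ≅-refl {S} = record
      { to     = id
      ; to-iso = Identity.isGroupIsomorphism S.E.rawGroup S.E.refl
      ; to-ι   = λ _ → S.E.refl
      ; π-to   = λ _ → G.refl
      } where module S = Extension S

    ≅-trans : ∀ {S T U} → S ≅ T → T ≅ U → S ≅ U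
    ≅-trans {S} {T} {U} f g = record
      { to     = g.to ∘ f.to
      ; to-iso = Composition.isGroupIsomorphism U.E.trans f.to-iso g.to-iso
      ; to-ι   = λ x → U.E.trans (GI.⟦⟧-cong (f.to-ι x)) (g.to-ι x)
      ; π-to   = λ e → G.trans (g.π-to (f.to e)) (f.π-to e)
      }
      where
      module U = Extension U
      module T = Extension T
      module f = _≅_ f
      module g = _≅_ g
      module GI = GroupMorphisms.IsGroupIsomorphism g.to-iso

    ≅-sym : ∀ {S T} → S ≅ T → T ≅ S
    ≅-sym {S} {T} f = record
      { to     = from
      ; to-iso = record
        { isGroupMonomorphism = record
          { isGroupHomomorphism = record
            { isMonoidHomomorphism = record
              { isMagmaHomomorphism = record
                { isRelHomomorphism = record { cong = from-cong }
                ; homo = λ x y → F.injective (T.E.trans (to-from (x T.E.∙ y))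
                    (T.E.sym (T.E.trans (F.∙-homo (from x) (from y))
                      (T.E.∙-cong (to-from x) (to-from y)))))
                }
              ; ε-homo = F.injective (T.E.trans (to-from T.E.ε) (T.E.sym F.ε-homo))
              }
            ; ⁻¹-homo = λ x → F.injective (T.E.trans (to-from (x T.E.⁻¹))
                (T.E.sym (T.E.trans (F.⁻¹-homo (from x)) (T.E.⁻¹-cong (to-from x)))))
            }
          ; injective = λ {x} {y} eq → T.E.trans (T.E.sym (to-from x))
              (T.E.trans (F.⟦⟧-cong eq) (to-from y))
          }
        ; surjective = λ s → f.to s , λ z≈ → F.injective (T.E.trans (to-from _) z≈)
        }
      ; to-ι   = λ x → F.injective (T.E.trans (to-from (T.ι x)) (T.E.sym (f.to-ι x)))
      ; π-to   = λ e → G.trans (G.sym (f.π-to (from e)))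
                   (GroupMorphisms.IsGroupHomomorphism.⟦⟧-cong T.π-homo (to-from e))
      }
      where
      module S = Extension S
      module T = Extension T
      module f = _≅_ f
      module F = GroupMorphisms.IsGroupIsomorphism f.to-iso

      from : T.E.Carrier → S.E.Carrier
      from t = proj₁ (F.surjective t)

      to-from : ∀ t → f.to (from t) T.E.≈ t
      to-from t = proj₂ (F.surjective t) S.E.refl

      from-cong : ∀ {x y} → x T.E.≈ y → from x S.E.≈ from y
      from-cong {x} {y} x≈y = F.injective
        (T.E.trans (to-from x) (T.E.trans x≈y (T.E.sym (to-from y))))

  -- The set of equivalence classes of extensions of X by G.
  Ext : Setoid (lsuc (a ⊔ b ⊔ c ⊔ d)) (a ⊔ b ⊔ c ⊔ d)
  Ext = record
    { Carrier = Extension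
    ; _≈_     = _≅_
    ; isEquivalence = record { refl = ≅-refl ; sym = ≅-sym ; trans = ≅-trans }
    }

  -- The zero element of Ext for the Baer sum.
  split : Extension
  split = record
    { E = DirectProduct.abelianGroup X G
    ; ι = λ x → x , G.ε
    ; π = proj₂
    ; ι-mono = record
      { isGroupHomomorphism = record
        { isMonoidHomomorphism = record
          { isMagmaHomomorphism = record
            { isRelHomomorphism = record { cong = λ x≈y → x≈y , G.refl }
            ; homo = λ _ _ → X.refl , G.sym (G.identityˡ G.ε)
            }
          ; ε-homo = X.refl , G.refl
          }
        ; ⁻¹-homo = λ _ → X.refl , G.sym (AbelianGroupProperties.ε⁻¹≈ε G)
        }
      ; injective = proj₁
      }
    ; π-homo = record
      { isMonoidHomomorphism = record
        { isMagmaHomomorphism = record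
          { isRelHomomorphism = record { cong = proj₂ }
          ; homo = λ _ _ → G.refl
          }
        ; ε-homo = G.refl
        }
      ; ⁻¹-homo = λ _ → G.refl
      }
    ; π-surjective = λ g → (X.ε , g) , proj₂
    ; exact = λ (x , g) → mk⇔ (λ g≈ε → x , X.refl , G.sym g≈ε)
                              (λ (_ , _ , ε≈g) → G.sym ε≈g)
    }

infix 8 ⊥_

⊥_ : AbelianGroup c d → Pred (AbelianGroup a b) (lsuc (a ⊔ b ⊔ c ⊔ d))
(⊥ X) G = ∀ E → Setoid._≈_ (Ext G X) E (split G X)

ℚ⁺ : AbelianGroup 0ℓ 0ℓ
ℚ⁺ = ℚ.+-0-abelianGroup

infix 9 ℤ^_

ℤ^_ : Set a → AbelianGroup a a
ℤ^ κ = Pointwise.abelianGroup κ ℤ.+-0-abelianGroup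

-- The direct sum ℤ^(κ): functions vanishing off some finite list of indices.
ℤ^⟨_⟩ : (κ : Set a) → Subgroup (ℤ^ κ) a
ℤ^⟨ κ ⟩ = record
  { member    = λ f → ∃[ is ] ∀ i → i ∉ is → f i ≡ + 0
  ; resp      = λ f≈g (is , f0) → is , λ i i∉ → ≡.trans (≡.sym (f≈g i)) (f0 i i∉)
  ; ε-closed  = [] , λ _ _ → ≡.refl
  ; ∙-closed  = λ (is , f0) (js , g0) → is ++ js , λ i i∉ →
      ≡.cong₂ ℤ._+_ (f0 i (i∉ ∘ ∈-++⁺ˡ)) (g0 i (i∉ ∘ ∈-++⁺ʳ is))
  ; ⁻¹-closed = λ (is , f0) → is , λ i i∉ → ≡.cong ℤ.-_ (f0 i i∉)
  }

B^<∞ : (κ : Set a) → Subgroup (ℤ^ κ) a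
B^<∞ κ = record
  { member    = λ f → ∃[ N ] ∀ i → ∣ f i ∣ ℕ.≤ N
  ; resp      = λ f≈g (N , f≤) → N , λ i → ≡.subst (λ x → ∣ x ∣ ℕ.≤ N) (f≈g i) (f≤ i)
  ; ε-closed  = 0 , λ _ → ℕ.z≤n
  ; ∙-closed  = λ {f} {g} (M , f≤) (N , g≤) → M ℕ.+ N , λ i →
      ℕ.≤-trans (ℤ.∣i+j∣≤∣i∣+∣j∣ (f i) (g i)) (ℕ.+-mono-≤ (f≤ i) (g≤ i))
  ; ⁻¹-closed = λ {f} (N , f≤) → N , λ i →
      ≡.subst (ℕ._≤ N) (≡.sym (ℤ.∣-i∣≡∣i∣ (f i))) (f≤ i)
  }

-- ∏ₙ pⁿℤ, so that ℤ^ ℕ / powers p is ∏ₙ ℤ/pⁿℤ.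
powers : ℕ → Subgroup (ℤ^ ℕ) 0ℓ
powers p = record
  { member    = λ x → ∀ n → + (p ℕ.^ n) ℤ.∣ x n
  ; resp      = λ x≈y p∣x n → ≡.subst (+ (p ℕ.^ n) ℤ.∣_) (x≈y n) (p∣x n)
  ; ε-closed  = λ n → ℤ.∣ᵤ⇒∣ ((p ℕ.^ n) ℕ.∣0)
  ; ∙-closed  = λ p∣x p∣y n → ℤ.∣m∣n⇒∣m+n (p∣x n) (p∣y n)
  ; ⁻¹-closed = λ p∣x n → ℤ.∣m⇒∣-m (p∣x n)
  }

-- The inverse limit of the rings ℤ/pⁿℤ, as a subgroup of their product.
coherent : (p : ℕ) → Subgroup (ℤ^ ℕ / powers p) 0ℓ
coherent p = record
  { member    = λ x → ∀ n → + (p ℕ.^ n) ℤ.∣ x (suc n) ℤ.- x n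
  ; resp      = λ {x} {y} x∼y cx n → ≡.subst (+ (p ℕ.^ n) ℤ.∣_)
      (shift (x n) (x (suc n)) (y n) (y (suc n)))
      (ℤ.∣m∣n⇒∣m+n (ℤ.∣m∣n⇒∣m-n (cx n) (ℤ.∣-trans (pⁿ∣pⁿ⁺¹ n) (x∼y (suc n)))) (x∼y n))
  ; ε-closed  = λ n → ℤ.∣ᵤ⇒∣ ((p ℕ.^ n) ℕ.∣0)
  ; ∙-closed  = λ {x} {y} cx cy n → ≡.subst (+ (p ℕ.^ n) ℤ.∣_)
      (add (x n) (x (suc n)) (y n) (y (suc n))) (ℤ.∣m∣n⇒∣m+n (cx n) (cy n))
  ; ⁻¹-closed = λ {x} cx n → ≡.subst (+ (p ℕ.^ n) ℤ.∣_)
      (neg (x n) (x (suc n))) (ℤ.∣m⇒∣-m (cx n))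
  }
  where
  pⁿ∣pⁿ⁺¹ : ∀ n → + (p ℕ.^ n) ℤ.∣ + (p ℕ.^ suc n)
  pⁿ∣pⁿ⁺¹ n = ℤ.∣ᵤ⇒∣ (ℕ.n∣m*n p)

  shift : ∀ x x′ y y′ → ((x′ ℤ.- x) ℤ.- (x′ ℤ.- y′)) ℤ.+ (x ℤ.- y) ≡ y′ ℤ.- y
  shift = solve-∀

  add : ∀ x x′ y y′ → (x′ ℤ.- x) ℤ.+ (y′ ℤ.- y) ≡ (x′ ℤ.+ y′) ℤ.- (x ℤ.+ y)
  add = solve-∀

  neg : ∀ x x′ → ℤ.- (x′ ℤ.- x) ≡ (ℤ.- x′) ℤ.- (ℤ.- x)
  neg = solve-∀

J : ℕ → AbelianGroup 0ℓ 0ℓ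
J p = ⌊ coherent p ⌋

{-# OPTIONS --safe #-}
module Submission where

-- By Diaconescu's theorem and Zorn's lemma, both consequences of choice, a partial
-- homomorphism E → M extends to a maximal one.  If M is divisible, the maximal one
-- is total, so every extension of M splits; ℚ is divisible, and so is ℤ^κ / B^<∞,
-- by division with bounded remainder.  This settles (1) and (3).
--
-- In (2) both sides are the class of torsion-free groups.  If M is torsion-free and
-- solves every consistent system of congruences in one unknown, then every extension
-- of M by a torsion-free group splits: a maximal partial retraction that preserves
-- divisibility is total, since its value at a new element x only has to satisfy the
-- congruences dictated by the divisors of x modulo the domain.  Such systems are
-- solved in ℤ^ω / ℤ^(ω) by a diagonal sequence, and in J_p by p-adic completeness.
-- Conversely, let g ∈ G have prime order p, and choose m ∈ M outside pM.  Since ℚ/ℤ is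
-- divisible, some χ : G → ℚ/ℤ maps g to 1/p.  Pulling ℤ → ℚ → ℚ/ℤ back along χ and
-- pushing the result out along ℤ → M, 1 ↦ m, gives an extension of M by G in which
-- m is p times a lift of g, so that a retraction onto M would divide m by p.

open import Algebra.Bundles using (AbelianGroup)
import Algebra.Construct.DirectProduct as DirectProduct
open import Algebra.Morphism.Structures using (module GroupMorphisms)
import Algebra.Properties.AbelianGroup as AbelianGroupProperties
import Algebra.Properties.CommutativeMonoid.Mult as CommutativeMonoidMult
import Algebra.Properties.CommutativeSemigroup as CommutativeSemigroupProperties
import Algebra.Properties.Monoid.Mult as MonoidMult
open import Data.Bool.Base using (Bool; true; false; T)
import Data.Bool.Properties as Bool
open import Data.Fin.Base using (Fin; zero; suc)
open import Data.Integer.Base as ℤ using (ℤ; +_; -[1+_]; ∣_∣)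
import Data.Integer.Divisibility.Signed as ℤ
import Data.Integer.DivMod as ℤ
import Data.Integer.Properties as ℤ
open import Data.Integer.Solver using (module +-*-Solver)
open import Data.Integer.Tactic.RingSolver using (solve-∀)
open import Data.List.Base using (List; []; _∷_; _++_; foldr; upTo)
open import Data.List.Membership.Propositional using (_∉_) renaming (_∈_ to _∈ˡ_)
open import Data.List.Membership.Propositional.Properties using (∈-++⁺ˡ; ∈-++⁺ʳ; ∈-upTo⁺)
open import Data.List.Relation.Unary.All using (All; []; _∷_)
open import Data.List.Relation.Unary.Any using (here; there)
open import Data.Nat.Base as ℕ using (ℕ; zero; suc; NonZero)
import Data.Nat.Divisibility as ℕ
import Data.Nat.GCD as ℕ
import Data.Nat.Induction as ℕ
open import Data.Nat.ListAction using (product)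
open import Data.Nat.Primality
  using (Prime; prime⇒nonZero; prime⇒nonTrivial; prime⇒irreducible; ¬prime[1])
open import Data.Nat.Primality.Factorisation using (factorise; module PrimeFactorisation)
import Data.Nat.Properties as ℕ
open import Data.Product.Base using (Σ; ∃; ∃-syntax; _×_; _,_; proj₁; proj₂)
open import Data.Rational.Base as ℚ using (ℚ; 0ℚ; 1ℚ)
import Data.Rational.Properties as ℚ
open import Data.Sum.Base using (_⊎_; inj₁; inj₂)
open import Data.Unit.Base using (⊤)
open import Data.Vec.Base using (Vec; []; _∷_; lookup; map; allFin)
open import Data.Vec.N-ary using (N-ary; _$ⁿ_)
open import Function.Base using (_∘_)
open import Function.Bundles using (Equivalence; Func; Surjection; mk⇔)
open import Level using (Level; 0ℓ; _⊔_) renaming (suc to lsuc)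
open import Relation.Binary.Bundles using (Setoid)
open import Relation.Binary.PropositionalEquality as ≡ using (_≡_)
import Relation.Binary.Reasoning.Setoid as SetoidReasoning
open import Relation.Nullary using (Dec; yes; no; ¬_; contradiction; isYes; toWitness; fromWitness)
open import Relation.Unary using (U; _≐_; ⋂)
open import Defs
open +-*-Solver using (Polynomial; con; _:+_; _:*_; :-_; _:-_; ⟦_⟧; ⟦_⟧↓; prove)
  renaming (var to :var)

private
  variable
    a b c d p : Level

-- Integer multiples in abelian groups

module IntegerMultiples (A : AbelianGroup a b) where
  open AbelianGroup A
  open AbelianGroupProperties A
  open MonoidMult monoid using (×-homo-+; ×-congʳ) renaming (_×_ to _⋆_)
  open CommutativeMonoidMult commutativeMonoid using (×-distrib-+)
  open CommutativeSemigroupProperties commutativeSemigroup using (interchange)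
  open SetoidReasoning setoid

  infixr 7.5 _·_

  _·_ : ℤ → Carrier → Carrier
  + n      · x = n ⋆ x
  -[1+ n ] · x = (suc n ⋆ x) ⁻¹

  ·-congˡ : ∀ i {x y} → x ≈ y → i · x ≈ i · y
  ·-congˡ (+ n)    x≈y = ×-congʳ n x≈y
  ·-congˡ -[1+ n ] x≈y = ⁻¹-cong (×-congʳ (suc n) x≈y)

  ·-congʳ : ∀ {i j} x → i ≡ j → i · x ≈ j · x
  ·-congʳ x ≡.refl = refl

  ·-identity : ∀ x → + 1 · x ≈ x
  ·-identity = identityʳ

  ·-distrib-⁻¹ : ∀ i x → (ℤ.- i) · x ≈ (i · x) ⁻¹
  ·-distrib-⁻¹ (+ zero)  x = sym ε⁻¹≈ε
  ·-distrib-⁻¹ (+ suc n) x = refl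
  ·-distrib-⁻¹ -[1+ n ]  x = sym (⁻¹-involutive _)

  ⊖-· : ∀ m n x → (m ℤ.⊖ n) · x ≈ m ⋆ x ∙ (n ⋆ x) ⁻¹
  ⊖-· m       zero    x = sym (trans (∙-congˡ ε⁻¹≈ε) (identityʳ _))
  ⊖-· zero    (suc n) x = sym (identityˡ _)
  ⊖-· (suc m) (suc n) x = begin
    (suc m ℤ.⊖ suc n) · x                ≈⟨ ·-congʳ x (ℤ.[1+m]⊖[1+n]≡m⊖n m n) ⟩
    (m ℤ.⊖ n) · x                        ≈⟨ ⊖-· m n x ⟩
    m ⋆ x ∙ (n ⋆ x) ⁻¹                   ≈⟨ identityˡ _ ⟨
    ε ∙ (m ⋆ x ∙ (n ⋆ x) ⁻¹)             ≈⟨ ∙-congʳ (inverseʳ x) ⟨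
    (x ∙ x ⁻¹) ∙ (m ⋆ x ∙ (n ⋆ x) ⁻¹)    ≈⟨ interchange _ _ _ _ ⟩
    (x ∙ m ⋆ x) ∙ (x ⁻¹ ∙ (n ⋆ x) ⁻¹)    ≈⟨ ∙-congˡ (⁻¹-∙-comm _ _) ⟩
    (x ∙ m ⋆ x) ∙ (x ∙ n ⋆ x) ⁻¹         ∎

  +-· : ∀ i j x → (i ℤ.+ j) · x ≈ i · x ∙ j · x
  +-· (+ m)    (+ n)    x = ×-homo-+ x m n
  +-· (+ m)    -[1+ n ] x = ⊖-· m (suc n) x
  +-· -[1+ m ] (+ n)    x = trans (⊖-· n (suc m) x) (comm _ _)
  +-· -[1+ m ] -[1+ n ] x = begin
    (suc (suc (m ℕ.+ n)) ⋆ x) ⁻¹              ≈⟨ ⁻¹-cong (·-congʳ x (≡.cong (+_ ∘ suc) (ℕ.+-suc m n))) ⟨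
    ((suc m ℕ.+ suc n) ⋆ x) ⁻¹                ≈⟨ ⁻¹-cong (×-homo-+ x (suc m) (suc n)) ⟩
    (suc m ⋆ x ∙ suc n ⋆ x) ⁻¹                ≈⟨ ⁻¹-∙-comm _ _ ⟨
    (suc m ⋆ x) ⁻¹ ∙ (suc n ⋆ x) ⁻¹           ∎

  ·-distrib-∙ : ∀ i x y → i · (x ∙ y) ≈ i · x ∙ i · y
  ·-distrib-∙ (+ n)    x y = ×-distrib-+ x y n
  ·-distrib-∙ -[1+ n ] x y = trans (⁻¹-cong (×-distrib-+ x y (suc n))) (sym (⁻¹-∙-comm _ _))

  *-· : ∀ i j x → (i ℤ.* j) · x ≈ i · (j · x)
  *-· (+ n)    j x = go n
    where
    go : ∀ n → (+ n ℤ.* j) · x ≈ n ⋆ (j · x)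
    go zero    = refl
    go (suc n) = begin
      (+ suc n ℤ.* j) · x       ≈⟨ ·-congʳ x (ℤ.suc-* (+ n) j) ⟩
      (j ℤ.+ + n ℤ.* j) · x     ≈⟨ +-· j _ x ⟩
      j · x ∙ (+ n ℤ.* j) · x   ≈⟨ ∙-congˡ (go n) ⟩
      j · x ∙ n ⋆ (j · x)       ∎
  *-· -[1+ n ] j x = begin
    (-[1+ n ] ℤ.* j) · x         ≈⟨ ·-congʳ x (ℤ.neg-distribˡ-* (+ suc n) j) ⟨
    (ℤ.- (+ suc n ℤ.* j)) · x    ≈⟨ ·-distrib-⁻¹ (+ suc n ℤ.* j) x ⟩
    ((+ suc n ℤ.* j) · x) ⁻¹     ≈⟨ ⁻¹-cong (*-· (+ suc n) j x) ⟩
    (suc n ⋆ (j · x)) ⁻¹         ∎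

  ·-ε : ∀ i → i · ε ≈ ε
  ·-ε i = begin
    i · ε               ≈⟨ *-· i (+ 0) ε ⟨
    (i ℤ.* + 0) · ε     ≈⟨ ·-congʳ ε (ℤ.*-zeroʳ i) ⟩
    ε                   ∎

  infixl 6 _⊕_ _⊝_
  infix  7 ⊖_
  infixr 7.5 _⊙_

  -- ℤ-linear expressions in n elements of A, with polynomials in m integers as
  -- coefficients.
  data Expr (m n : ℕ) : Set where
    var     : Fin n → Expr m n
    𝟘       : Expr m n
    _⊕_     : Expr m n → Expr m n → Expr m n
    ⊖_      : Expr m n → Expr m n
    _⊙_     : Polynomial m → Expr m n → Expr m n

  private
    variable
      m n : ℕ

  eval : Vec ℤ m → Expr m n → Vec Carrier n → Carrier
  eval ρ (var i) v = lookup v i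
  eval ρ 𝟘       v = ε
  eval ρ (e ⊕ f) v = eval ρ e v ∙ eval ρ f v
  eval ρ (⊖ e)   v = eval ρ e v ⁻¹
  eval ρ (p ⊙ e) v = ⟦ p ⟧ ρ · eval ρ e v

  _⊝_ : Expr m n → Expr m n → Expr m n
  e ⊝ f = e ⊕ ⊖ f

  private
    δ : Fin n → Fin n → Polynomial m
    δ zero    zero    = con (+ 1)
    δ zero    (suc _) = con (+ 0)
    δ (suc _) zero    = con (+ 0)
    δ (suc i) (suc j) = δ i j

    coefficient : Expr m n → Fin n → Polynomial m
    coefficient (var i) j = δ i j
    coefficient 𝟘       j = con (+ 0)
    coefficient (e ⊕ f) j = coefficient e j :+ coefficient f j
    coefficient (⊖ e)   j = :- coefficient e j
    coefficient (p ⊙ e) j = p :* coefficient e j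

    combination : (Fin n → ℤ) → Vec Carrier n → Carrier
    combination c []      = ε
    combination c (x ∷ v) = c zero · x ∙ combination (c ∘ suc) v

    combination-0 : (v : Vec Carrier n) → combination (λ _ → + 0) v ≈ ε
    combination-0 []      = refl
    combination-0 (x ∷ v) = trans (identityˡ _) (combination-0 v)

    combination-δ : (ρ : Vec ℤ m) (i : Fin n) (v : Vec Carrier n) →
      combination (λ j → ⟦ δ i j ⟧ ρ) v ≈ lookup v i
    combination-δ ρ zero    (x ∷ v) = trans (∙-cong (·-identity x) (combination-0 v)) (identityʳ x)
    combination-δ ρ (suc i) (x ∷ v) = trans (identityˡ _) (combination-δ ρ i v)

    combination-+ : (c d : Fin n → ℤ) (v : Vec Carrier n) →
      combination (λ i → c i ℤ.+ d i) v ≈ combination c v ∙ combination d v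
    combination-+ c d []      = sym (identityˡ ε)
    combination-+ c d (x ∷ v) =
      trans (∙-cong (+-· (c zero) (d zero) x) (combination-+ _ _ v)) (interchange _ _ _ _)

    combination-* : ∀ k (c : Fin n → ℤ) (v : Vec Carrier n) →
      combination (λ i → k ℤ.* c i) v ≈ k · combination c v
    combination-* k c []      = sym (·-ε k)
    combination-* k c (x ∷ v) =
      trans (∙-cong (*-· k (c zero) x) (combination-* k _ v)) (sym (·-distrib-∙ k _ _))

    combination-neg : (c : Fin n → ℤ) (v : Vec Carrier n) →
      combination (λ i → ℤ.- c i) v ≈ combination c v ⁻¹
    combination-neg c []      = sym ε⁻¹≈ε
    combination-neg c (x ∷ v) =
      trans (∙-cong (·-distrib-⁻¹ (c zero) x) (combination-neg _ v)) (⁻¹-∙-comm _ _)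

    combination-cong : (c d : Fin n → ℤ) (v : Vec Carrier n) → (∀ i → c i ≡ d i) →
      combination c v ≈ combination d v
    combination-cong c d []      c≡d = refl
    combination-cong c d (x ∷ v) c≡d =
      ∙-cong (·-congʳ x (c≡d zero)) (combination-cong _ _ v (c≡d ∘ suc))

    correct : (ρ : Vec ℤ m) (e : Expr m n) (v : Vec Carrier n) →
      combination (λ i → ⟦ coefficient e i ⟧ ρ) v ≈ eval ρ e v
    correct ρ (var i) v = combination-δ ρ i v
    correct ρ 𝟘       v = combination-0 v
    correct ρ (e ⊕ f) v =
      trans (combination-+ _ _ v) (∙-cong (correct ρ e v) (correct ρ f v))
    correct ρ (⊖ e)   v = trans (combination-neg _ v) (⁻¹-cong (correct ρ e v))
    correct ρ (p ⊙ e) v =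
      trans (combination-* (⟦ p ⟧ ρ) _ v) (·-congˡ (⟦ p ⟧ ρ) (correct ρ e v))

    -- A tuple over the elements instead of a function on `Fin n`: for a concrete `n` it is proved
    -- by one `≡.refl` per element, each checked by normalising two polynomials.
    Agree : Vec ℤ m → ∀ n → (Fin n → Polynomial m) → (Fin n → Polynomial m) → Set
    Agree ρ zero    c d = ⊤
    Agree ρ (suc n) c d = ⟦ c zero ⟧↓ ρ ≡ ⟦ d zero ⟧↓ ρ × Agree ρ n (c ∘ suc) (d ∘ suc)

    agree : (ρ : Vec ℤ m) (c d : Fin n → Polynomial m) → Agree ρ n c d →
      ∀ i → ⟦ c i ⟧ ρ ≡ ⟦ d i ⟧ ρ
    agree ρ c d (p , _)  zero    = prove ρ (c zero) (d zero) p
    agree ρ c d (_ , ps) (suc i) = agree ρ (c ∘ suc) (d ∘ suc) ps i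

    -- Lets both sides of an identity be written as one function of named coefficients and elements.
    close : N-ary m (Polynomial m) (N-ary n (Expr m n) (Expr m n × Expr m n)) →
      Expr m n × Expr m n
    close {m} {n} f = (f $ⁿ map :var (allFin m)) $ⁿ map var (allFin n)

  -- Proves an identity between ℤ-linear expressions by normalising, for each
  -- element, the two coefficient polynomials.
  linear : (ρ : Vec ℤ m) (v : Vec Carrier n)
    (f : N-ary m (Polynomial m) (N-ary n (Expr m n) (Expr m n × Expr m n))) →
    let e₁ , e₂ = close f in
    Agree ρ n (coefficient e₁) (coefficient e₂) → eval ρ e₁ v ≈ eval ρ e₂ v
  linear ρ v f p = let e₁ , e₂ = close f in
    trans (sym (correct ρ e₁ v))
      (trans (combination-cong _ _ v (agree ρ (coefficient e₁) (coefficient e₂) p))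
        (correct ρ e₂ v))

-- Homomorphisms between abelian groups

module _ (A : AbelianGroup a b) (B : AbelianGroup c d) where
  private
    module A = AbelianGroup A
    module B = AbelianGroup B
    module Bᴾ = AbelianGroupProperties B
    module ℤA = IntegerMultiples A
    module ℤB = IntegerMultiples B

  -- Cancellation in `B` gives preservation of the unit and of inverses.
  isGroupHomomorphism : ∀ h → (∀ {x y} → x A.≈ y → h x B.≈ h y) →
    (∀ x y → h (x A.∙ y) B.≈ h x B.∙ h y) →
    GroupMorphisms.IsGroupHomomorphism A.rawGroup B.rawGroup h
  isGroupHomomorphism h cong homo = record
    { isMonoidHomomorphism = record
      { isMagmaHomomorphism = record
        { isRelHomomorphism = record { cong = cong }
        ; homo = homo
        }
      ; ε-homo = ε-homo
      }
    ; ⁻¹-homo = λ x → Bᴾ.inverseʳ-unique (h x) (h (x A.⁻¹))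
        (B.trans (B.sym (homo x (x A.⁻¹))) (B.trans (cong (A.inverseʳ x)) ε-homo))
    }
    where
    ε-homo : h A.ε B.≈ B.ε
    ε-homo = Bᴾ.identityʳ-unique (h A.ε) (h A.ε)
      (B.trans (B.sym (homo A.ε A.ε)) (cong (A.identityˡ A.ε)))

  ·-homo : ∀ {h} → GroupMorphisms.IsGroupHomomorphism A.rawGroup B.rawGroup h →
    ∀ i x → h (i ℤA.· x) B.≈ i ℤB.· h x
  ·-homo {h} φ = λ where
      (+ n)    x → go n x
      -[1+ n ] x → B.trans (⁻¹-homo _) (B.⁻¹-cong (go (suc n) x))
    where
    open GroupMorphisms.IsGroupHomomorphism φ
    go : ∀ n x → h (+ n ℤA.· x) B.≈ + n ℤB.· h x
    go zero    x = ε-homo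
    go (suc n) x = B.trans (homo _ _) (B.∙-congˡ (go n x))

-- Excluded middle and Zorn's lemma

module Classical (choice : ∀ {a b c d} → AxiomOfChoice a b c d) where

  -- Diaconescu: identify the two booleans when P holds, and choose representatives.
  lem : (P : Set a) → Dec P
  lem {a} P = decide (Func.to s true Bool.≟ Func.to s false)
    where
    Bool/P : Setoid 0ℓ a
    Bool/P = record
      { Carrier = Bool
      ; _≈_ = λ x y → x ≡ y ⊎ P
      ; isEquivalence = record
        { refl  = inj₁ ≡.refl
        ; sym   = λ { (inj₁ x≡y) → inj₁ (≡.sym x≡y) ; (inj₂ p) → inj₂ p }
        ; trans = λ { (inj₁ x≡y) (inj₁ y≡z) → inj₁ (≡.trans x≡y y≡z)
                    ; (inj₁ _) (inj₂ p) → inj₂ p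
                    ; (inj₂ p) _ → inj₂ p }
        }
      }

    collapse : Surjection (≡.setoid Bool) Bool/P
    collapse = record
      { to = λ x → x ; cong = inj₁ ; surjective = λ y → y , inj₁ }

    section = choice collapse
    s = proj₁ section

    decide : Dec (Func.to s true ≡ Func.to s false) → Dec P
    decide (no  s≢) = no λ p → s≢ (Func.cong s (inj₂ p))
    decide (yes s≡) with Setoid.trans Bool/P (Setoid.sym Bool/P (proj₂ section true))
                           (Setoid.trans Bool/P (inj₁ s≡) (proj₂ section false))
    ... | inj₂ p = yes p

  ¬¬-elim : {P : Set a} → ¬ ¬ P → P
  ¬¬-elim {P = P} ¬¬p with lem P
  ... | yes p = p
  ... | no ¬p = contradiction ¬p ¬¬p

  -- Excluded middle as resizing: `T ⟪ P ⟫` is equivalent to `P` and lies in `Set` whatever the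
  -- level of `P`.
  ⟪_⟫ : Set a → Bool
  ⟪ P ⟫ = isYes (lem P)

  ⟪⟫-intro : {P : Set a} → P → T ⟪ P ⟫
  ⟪⟫-intro = fromWitness

  ⟪⟫-elim : {P : Set a} → T ⟪ P ⟫ → P
  ⟪⟫-elim = toWitness

  least : (P : ℕ → Set a) → ∀ n → P n → ∃[ m ] P m × (∀ k → k ℕ.< m → ¬ P k)
  least P = ℕ.<-rec _ λ n rec Pn → search n rec Pn (lem (∃[ k ] k ℕ.< n × P k))
    where
    search : ∀ n → (∀ {k} → k ℕ.< n → P k → ∃[ m ] P m × (∀ k → k ℕ.< m → ¬ P k)) → P n →
      Dec (∃[ k ] k ℕ.< n × P k) → ∃[ m ] P m × (∀ k → k ℕ.< m → ¬ P k)
    search n rec Pn (yes (k , k<n , Pk)) = rec k<n Pk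
    search n rec Pn (no ¬k) = n , Pn , λ k k<n Pk → ¬k (k , k<n , Pk)

-- Boolean-valued predicates keep the collection of subsets of a set at the
-- level of that set; excluded middle makes every predicate Boolean.
module Subsets (X : Set a) where

  Subset : Set a
  Subset = X → Bool

  infix 4 _∈_ _⊆_ _≋_

  _∈_ : X → Subset → Set
  x ∈ R = T (R x)

  _⊆_ _≋_ : Subset → Subset → Set a
  R ⊆ S = ∀ x → x ∈ R → x ∈ S
  R ≋ S = R ⊆ S × S ⊆ R

  ≋-refl : ∀ {R} → R ≋ R
  ≋-refl = (λ _ r → r) , (λ _ r → r)

  ≋-sym : ∀ {R S} → R ≋ S → S ≋ R
  ≋-sym (p , q) = q , p

  ≋-trans : ∀ {R S U} → R ≋ S → S ≋ U → R ≋ U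
  ≋-trans (p , q) (p′ , q′) = (λ x r → p′ x (p x r)) , (λ x u → q x (q′ x u))

  Chain : (Subset → Bool) → Set a
  Chain F = ∀ R S → T (F R) → T (F S) → R ⊆ S ⊎ S ⊆ R

module Zorn (choice : ∀ {a b c d} → AxiomOfChoice a b c d) (X : Set a) where
  open Classical choice
  open Subsets X

  ⋃ : (Subset → Bool) → Subset
  ⋃ F x = ⟪ (∃[ R ] T (F R) × x ∈ R) ⟫

  ∈-⋃ : ∀ {F} R {x} → T (F R) → x ∈ R → x ∈ ⋃ F
  ∈-⋃ R FR x∈R = ⟪⟫-intro (R , FR , x∈R)

  module _ (P : Subset → Set b) where

    -- Bourbaki–Witt: iterate a choice of proper extensions transfinitely from R₀;
    -- the iterates form a chain, whose union cannot be extended properly.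
    module _
      (R₀ : Subset) (PR₀ : P R₀)
      (P-⋃ : ∀ F → ∃[ R ] T (F R) → Chain F → (∀ R → T (F R) → P R) → P (⋃ F))
      where

      private
        ProperExtension : Subset → Subset → Set (a ⊔ b)
        ProperExtension R S = P S × R ⊆ S × ¬ (S ⊆ R)

        -- Subsets are compared by `≋`, so a choice of proper extensions must respect `≋`. The
        -- equality of this setoid forgets the extension and that of `Extended` retains it; a
        -- section of the identity map between them is such a choice.
        Extensible : Setoid (a ⊔ b) a
        Extensible = record
          { Carrier = Σ Subset λ R → Σ Subset (ProperExtension R)
          ; _≈_ = λ (R , _) (S , _) → R ≋ S
          ; isEquivalence = record { refl = ≋-refl ; sym = ≋-sym ; trans = ≋-trans }
          }

        Extended : Setoid (a ⊔ b) a
        Extended = record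
          { Carrier = Σ Subset λ R → Σ Subset (ProperExtension R)
          ; _≈_ = λ (R , S , _) (R′ , S′ , _) → R ≋ R′ × S ≋ S′
          ; isEquivalence = record
            { refl  = ≋-refl , ≋-refl
            ; sym   = λ (p , q) → ≋-sym p , ≋-sym q
            ; trans = λ (p , q) (p′ , q′) → ≋-trans p p′ , ≋-trans q q′
            }
          }

        forget : Surjection Extended Extensible
        forget = record
          { to = λ e → e ; cong = proj₁ ; surjective = λ e → e , proj₁ }

        extend = proj₁ (choice forget)

        next′ : (R : Subset) → Dec (Σ Subset (ProperExtension R)) → Subset
        next′ R (yes e) = proj₁ (proj₂ (Func.to extend (R , e)))
        next′ R (no  _) = R

        next : Subset → Subset
        next R = next′ R (lem _)

        -- The section returns a proper extension of some `R′ ≋ R`, which is a proper extension of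
        -- `R` as well.
        chosen : ∀ R e → ProperExtension R (proj₁ (proj₂ (Func.to extend (R , e))))
        chosen R e with Func.to extend (R , e) | proj₂ (choice forget) (R , e)
        ... | R′ , S , PS , R′⊆S , S⊈R′ | R′⊆R , R⊆R′ =
          PS , (λ x r → R′⊆S x (R⊆R′ x r)) , λ S⊆R → S⊈R′ λ x s → R⊆R′ x (S⊆R x s)

        next-⊇ : ∀ R → R ⊆ next R
        next-⊇ R with lem (Σ Subset (ProperExtension R))
        ... | yes e = proj₁ (proj₂ (chosen R e))
        ... | no  _ = λ _ r → r

        next-P : ∀ R → P R → P (next R)
        next-P R PR with lem (Σ Subset (ProperExtension R))
        ... | yes e = proj₁ (chosen R e)
        ... | no  _ = PR

        -- `next R` is strictly larger than `R` unless `R` has no proper extension satisfying `P`.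
        next-maximal : ∀ R → next R ⊆ R → ∀ S → P S → R ⊆ S → S ⊆ R
        next-maximal R next⊆ S PS R⊆S with lem (Σ Subset (ProperExtension R))
        ... | yes e = contradiction next⊆ (proj₂ (proj₂ (chosen R e)))
        ... | no ¬e = ¬¬-elim λ S⊈R → ¬e (S , PS , R⊆S , S⊈R)

        transport : ∀ {R S} → R ≋ S → Σ Subset (ProperExtension R) → Σ Subset (ProperExtension S)
        transport (R⊆S , S⊆R) (U , PU , R⊆U , U⊈R) =
          U , PU , (λ x s → R⊆U x (S⊆R x s)) , λ U⊆S → U⊈R λ x u → S⊆R x (U⊆S x u)

        -- Extensibility is invariant under `≋`, so both sides fall into the same case; in the
        -- extensible one the section respects `≋`.
        next-cong : ∀ {R S} → R ≋ S → next R ⊆ next S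
        next-cong {R} {S} R≋S
          with lem (Σ Subset (ProperExtension R)) | lem (Σ Subset (ProperExtension S))
        ... | yes e | yes f = proj₁ (proj₂ (Func.cong extend R≋S))
        ... | yes e | no ¬f = contradiction (transport R≋S e) ¬f
        ... | no ¬e | yes f = contradiction (transport (≋-sym R≋S) f) ¬e
        ... | no  _ | no  _ = proj₁ R≋S

        -- The transfinite orbit of `R₀` without ordinals. `sup` admits arbitrary nonempty families
        -- of iterates; that they are chains is proved afterwards.
        data Iterate : Subset → Set a where
          base : Iterate R₀
          step : ∀ {R} → Iterate R → Iterate (next R)
          sup  : ∀ F → ∃[ R ] T (F R) → (∀ R → T (F R) → Iterate R) → Iterate (⋃ F)

        R₀⊆ : ∀ {R} → Iterate R → R₀ ⊆ R
        R₀⊆ base         x r = r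
        R₀⊆ (step {R} i) x r = next-⊇ R x (R₀⊆ i x r)
        R₀⊆ (sup F (R , FR) i) x r = ∈-⋃ R FR (R₀⊆ (i R FR) x r)

        -- The extreme points of the Bourbaki-Witt argument. All iterates turn out to be extreme,
        -- which makes any two of them comparable.
        Extreme : Subset → Set a
        Extreme R = ∀ {S} → Iterate S → S ⊆ R → S ≋ R ⊎ next S ⊆ R

        -- Induction on `S`: as long as `S` stays inside `R`, extremality either keeps its successor
        -- inside `R` or makes `S` equal to `R`, and then the successors agree.
        extreme-compare : ∀ {R S} → Extreme R → Iterate R → Iterate S → S ⊆ R ⊎ next R ⊆ S
        extreme-compare ext i base = inj₁ (R₀⊆ i)
        extreme-compare ext i (step {S} j) with extreme-compare ext i j
        ... | inj₂ nR⊆S = inj₂ λ x r → next-⊇ S x (nR⊆S x r)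
        ... | inj₁ S⊆R with ext j S⊆R
        ...   | inj₁ S≋R  = inj₂ (next-cong (≋-sym S≋R))
        ...   | inj₂ nS⊆R = inj₁ nS⊆R
        extreme-compare {R} ext i (sup F _ j) with lem (∃[ S ] T (F S) × next R ⊆ S)
        ... | yes (S , FS , nR⊆S) = inj₂ λ x r → ∈-⋃ S FS (nR⊆S x r)
        ... | no ¬S = inj₁ λ x x∈⋃ → let S , FS , x∈S = ⟪⟫-elim x∈⋃ in
                below S FS (extreme-compare ext i (j S FS)) x x∈S
          where
          below : ∀ S → T (F S) → S ⊆ R ⊎ next R ⊆ S → S ⊆ R
          below S FS (inj₁ S⊆R)  = S⊆R
          below S FS (inj₂ nR⊆S) = contradiction (S , FS , nR⊆S) ¬S

        extreme : ∀ {R} → Iterate R → Extreme R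
        extreme base j S⊆R₀ = inj₁ (S⊆R₀ , R₀⊆ j)
        extreme (step {R} i) j S⊆nR with extreme-compare (extreme i) i j
        ... | inj₂ nR⊆S = inj₁ (S⊆nR , nR⊆S)
        ... | inj₁ S⊆R with extreme i j S⊆R
        ...   | inj₁ S≋R  = inj₂ (next-cong S≋R)
        ...   | inj₂ nS⊆R = inj₂ λ x s → next-⊇ R x (nS⊆R x s)
        extreme (sup F F≠∅ i) {S} j S⊆⋃ with lem (∃[ R ] T (F R) × S ⊆ R)
        ... | no ¬R = inj₁ (S⊆⋃ , λ x x∈⋃ → let R , FR , x∈R = ⟪⟫-elim x∈⋃ in
                below R FR (extreme-compare (extreme (i R FR)) (i R FR) j) x x∈R)
          where
          below : ∀ R → T (F R) → S ⊆ R ⊎ next R ⊆ S → R ⊆ S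
          below R FR (inj₁ S⊆R)  = contradiction (R , FR , S⊆R) ¬R
          below R FR (inj₂ nR⊆S) = λ x r → nR⊆S x (next-⊇ R x r)
        ... | yes (R , FR , S⊆R) with extreme (i R FR) j S⊆R
        ...   | inj₂ nS⊆R = inj₂ λ x s → ∈-⋃ R FR (nS⊆R x s)
        -- `S` equals a member `R` of the family. Comparing `R` with the whole union tells whether
        -- `S` is already the union or `next S` still fits inside it.
        ...   | inj₁ S≋R with extreme-compare (extreme (i R FR)) (i R FR) (sup F F≠∅ i)
        ...     | inj₁ ⋃⊆R  = inj₁ (S⊆⋃ , λ x x∈⋃ → proj₂ S≋R x (⋃⊆R x x∈⋃))
        ...     | inj₂ nR⊆⋃ = inj₂ λ x s → nR⊆⋃ x (next-cong S≋R x s)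

        comparable : ∀ {R S} → Iterate R → Iterate S → R ⊆ S ⊎ S ⊆ R
        comparable {R} i j with extreme-compare (extreme i) i j
        ... | inj₁ S⊆R  = inj₂ S⊆R
        ... | inj₂ nR⊆S = inj₁ λ x r → nR⊆S x (next-⊇ R x r)

        iterate-P : ∀ {R} → Iterate R → P R
        iterate-P base         = PR₀
        iterate-P (step {R} i) = next-P R (iterate-P i)
        iterate-P (sup F F≠∅ i) =
          P-⋃ F F≠∅ (λ R S FR FS → comparable (i R FR) (i S FS)) λ R FR → iterate-P (i R FR)

        top-iterate : Iterate (⋃ λ R → ⟪ Iterate R ⟫)
        top-iterate = sup _ (R₀ , ⟪⟫-intro base) λ _ → ⟪⟫-elim

      -- The union of all iterates is itself an iterate, so its successor is one too and lies inside
      -- it; a set that contains its successor is maximal.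
      zorn : ∃[ R ] R₀ ⊆ R × P R × (∀ S → P S → R ⊆ S → S ⊆ R)
      zorn = _ , R₀⊆ top-iterate , iterate-P top-iterate ,
        next-maximal _ λ x x∈ → ∈-⋃ _ (⟪⟫-intro (step top-iterate)) x∈

-- Maximal partial homomorphisms

Divisible : AbelianGroup a b → Set (a ⊔ b)
Divisible A = ∀ n x → ∃[ y ] + suc n · y ≈ x
  where
  open AbelianGroup A
  open IntegerMultiples A

module PartialHom (choice : ∀ {a b c d} → AxiomOfChoice a b c d)
  (E : AbelianGroup a b) (M : AbelianGroup c d) where

  open Classical choice
  private
    module E where
      open AbelianGroup E public
      open IntegerMultiples E public
    module M where
      open AbelianGroup M public
      open IntegerMultiples M public
  open E using () renaming (_·_ to _·ᴱ_)
  open M using () renaming (_·_ to _·ᴹ_)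
  open Subsets (E.Carrier × M.Carrier)
  open Zorn choice (E.Carrier × M.Carrier)

  -- The graph of a homomorphism from a subgroup of E to M.  For n = 0 the last
  -- condition says that the relation is functional.
  record IsPartialHom (R : Subset) : Set (a ⊔ b ⊔ c ⊔ d) where
    field
      resp      : ∀ {e e′ m m′} → e E.≈ e′ → m M.≈ m′ → (e , m) ∈ R → (e′ , m′) ∈ R
      ε-closed  : (E.ε , M.ε) ∈ R
      ∙-closed  : ∀ {e e′ m m′} → (e , m) ∈ R → (e′ , m′) ∈ R → (e E.∙ e′ , m M.∙ m′) ∈ R
      ⁻¹-closed : ∀ {e m} → (e , m) ∈ R → (e E.⁻¹ , m M.⁻¹) ∈ R
      preserves-multiples : ∀ n {e m} f → (e , m) ∈ R → e E.≈ + n ·ᴱ f → ∃[ w ] m M.≈ + n ·ᴹ w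

    ·-closed : ∀ i {e m} → (e , m) ∈ R → (i ·ᴱ e , i ·ᴹ m) ∈ R
    ·-closed (+ n)    r = go n
      where
      go : ∀ n → (+ n ·ᴱ _ , + n ·ᴹ _) ∈ R
      go zero    = ε-closed
      go (suc n) = ∙-closed r (go n)
    ·-closed -[1+ n ] r = ⁻¹-closed (·-closed (+ suc n) r)

    ε-functional : ∀ {e m} → (e , m) ∈ R → e E.≈ E.ε → m M.≈ M.ε
    ε-functional r e≈ε = proj₂ (preserves-multiples 0 E.ε r e≈ε)

    functional : ∀ {e m m′} → (e , m) ∈ R → (e , m′) ∈ R → m M.≈ m′
    functional {m = m} {m′} r r′ = M.trans
      (M.linear [] (m ∷ m′ ∷ []) (λ m m′ → m , (m M.⊝ m′) M.⊕ m′) (≡.refl , ≡.refl , _))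
      (M.trans (M.∙-congʳ (ε-functional (∙-closed r (⁻¹-closed r′)) (E.inverseʳ _))) (M.identityˡ m′))

  ⋃-isPartialHom : ∀ F → ∃[ R ] T (F R) → Chain F →
    (∀ R → T (F R) → IsPartialHom R) → IsPartialHom (⋃ F)
  ⋃-isPartialHom F (R₁ , FR₁) chain hom = record
    { resp      = λ e≈ m≈ x∈ → let R , FR , r = ⟪⟫-elim x∈ in
        ∈-⋃ R FR (IsPartialHom.resp (hom R FR) e≈ m≈ r)
    ; ε-closed  = ∈-⋃ R₁ FR₁ (IsPartialHom.ε-closed (hom R₁ FR₁))
    ; ∙-closed  = λ x∈ y∈ → let R , FR , r = ⟪⟫-elim x∈ ; S , FS , s = ⟪⟫-elim y∈ in
        add R FR r S FS s (chain R S FR FS)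
    ; ⁻¹-closed = λ x∈ → let R , FR , r = ⟪⟫-elim x∈ in
        ∈-⋃ R FR (IsPartialHom.⁻¹-closed (hom R FR) r)
    ; preserves-multiples = λ n f x∈ → let R , FR , r = ⟪⟫-elim x∈ in
        IsPartialHom.preserves-multiples (hom R FR) n f r
    }
    where
    add : ∀ R → T (F R) → ∀ {e m} → (e , m) ∈ R → ∀ S → T (F S) → ∀ {e′ m′} → (e′ , m′) ∈ S →
      R ⊆ S ⊎ S ⊆ R → (e E.∙ e′ , m M.∙ m′) ∈ ⋃ F
    add R FR r S FS s (inj₁ R⊆S) = ∈-⋃ S FS (IsPartialHom.∙-closed (hom S FS) (R⊆S _ r) s)
    add R FR r S FS s (inj₂ S⊆R) = ∈-⋃ R FR (IsPartialHom.∙-closed (hom R FR) r (S⊆R _ s))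

  record IsMaximal (R : Subset) : Set (a ⊔ b ⊔ c ⊔ d) where
    field
      isPartialHom : IsPartialHom R
      maximal      : ∀ S → IsPartialHom S → R ⊆ S → S ⊆ R
    open IsPartialHom isPartialHom public

    -- `R + ℤ(x , y)` satisfies the closure conditions automatically. The hypothesis says that it
    -- preserves multiples, and maximality then absorbs it into `R`.
    adjoin : ∀ x y →
      (∀ n k {s m} f → (s , m) ∈ R → s E.∙ k ·ᴱ x E.≈ + n ·ᴱ f → ∃[ w ] m M.∙ k ·ᴹ y M.≈ + n ·ᴹ w) →
      (x , y) ∈ R
    adjoin x y multiple = maximal R+ℤxy R+ℤxy-isPartialHom
      (λ (e , m) r → ⟪⟫-intro (+ 0 , e , m , r , E.sym (E.identityʳ e) , M.sym (M.identityʳ m)))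
      (x , y)
      (⟪⟫-intro (+ 1 , E.ε , M.ε , ε-closed
        , E.linear [] (x ∷ []) (λ x → x , E.𝟘 E.⊕ con (+ 1) E.⊙ x) (≡.refl , _)
        , M.linear [] (y ∷ []) (λ y → y , M.𝟘 M.⊕ con (+ 1) M.⊙ y) (≡.refl , _)))
      where
      R+ℤxy : Subset
      R+ℤxy (e , m) =
        ⟪ (∃[ k ] ∃[ s ] ∃[ n ] (s , n) ∈ R × e E.≈ s E.∙ k ·ᴱ x × m M.≈ n M.∙ k ·ᴹ y) ⟫

      R+ℤxy-isPartialHom : IsPartialHom R+ℤxy
      R+ℤxy-isPartialHom = record
        { resp = λ e≈ m≈ r → let k , s , n , sn , p , q = ⟪⟫-elim r in
            ⟪⟫-intro (k , s , n , sn , E.trans (E.sym e≈) p , M.trans (M.sym m≈) q)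
        ; ε-closed = ⟪⟫-intro (+ 0 , E.ε , M.ε , ε-closed
            , E.sym (E.identityʳ E.ε) , M.sym (M.identityʳ M.ε))
        ; ∙-closed = λ r r′ → let
              k , s , n , sn , p , q = ⟪⟫-elim r
              k′ , s′ , n′ , sn′ , p′ , q′ = ⟪⟫-elim r′
            in ⟪⟫-intro (k ℤ.+ k′ , s E.∙ s′ , n M.∙ n′ , ∙-closed sn sn′
              , E.trans (E.∙-cong p p′) (E.linear (k ∷ k′ ∷ []) (s ∷ s′ ∷ x ∷ [])
                  (λ k k′ s s′ x → (s E.⊕ k E.⊙ x) E.⊕ (s′ E.⊕ k′ E.⊙ x) , s E.⊕ s′ E.⊕ (k :+ k′) E.⊙ x)
                  (≡.refl , ≡.refl , ≡.refl , _))
              , M.trans (M.∙-cong q q′) (M.linear (k ∷ k′ ∷ []) (n ∷ n′ ∷ y ∷ [])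
                  (λ k k′ s s′ x → (s M.⊕ k M.⊙ x) M.⊕ (s′ M.⊕ k′ M.⊙ x) , s M.⊕ s′ M.⊕ (k :+ k′) M.⊙ x)
                  (≡.refl , ≡.refl , ≡.refl , _)))
        ; ⁻¹-closed = λ r → let k , s , n , sn , p , q = ⟪⟫-elim r in
            ⟪⟫-intro (ℤ.- k , s E.⁻¹ , n M.⁻¹ , ⁻¹-closed sn
              , E.trans (E.⁻¹-cong p) (E.linear (k ∷ []) (s ∷ x ∷ [])
                  (λ k s x → E.⊖ (s E.⊕ k E.⊙ x) , E.⊖ s E.⊕ (:- k) E.⊙ x)
                  (≡.refl , ≡.refl , _))
              , M.trans (M.⁻¹-cong q) (M.linear (k ∷ []) (n ∷ y ∷ [])
                  (λ k s x → M.⊖ (s M.⊕ k M.⊙ x) , M.⊖ s M.⊕ (:- k) M.⊙ x)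
                  (≡.refl , ≡.refl , _)))
        ; preserves-multiples = λ n f r e≈nf → let
              k , s , m , sm , p , q = ⟪⟫-elim r
              w , m+ky≈nw = multiple n k f sm (E.trans (E.sym p) e≈nf)
            in w , M.trans q m+ky≈nw
        }

  extendToMaximal : ∀ {R₀} → IsPartialHom R₀ → ∃[ R ] R₀ ⊆ R × IsMaximal R
  extendToMaximal hom₀ =
    let R , R₀⊆R , hom , max = zorn IsPartialHom _ hom₀ ⋃-isPartialHom in
    R , R₀⊆R , record { isPartialHom = hom ; maximal = max }

  Total : Subset → Set (a ⊔ c)
  Total R = ∀ e → ∃[ m ] (e , m) ∈ R

  total⇒hom : ∀ {R} → IsPartialHom R → (total : Total R) →
    GroupMorphisms.IsGroupHomomorphism E.rawGroup M.rawGroup (λ e → proj₁ (total e))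
  total⇒hom hom total = isGroupHomomorphism E M _
    (λ {x} {y} x≈y → functional (resp x≈y M.refl (proj₂ (total x))) (proj₂ (total y)))
    (λ x y → functional (proj₂ (total (x E.∙ y))) (∙-closed (proj₂ (total x)) (proj₂ (total y))))
    where open IsPartialHom hom

-- Extensions by divisible groups

module Splitting (G : AbelianGroup a b) (X : AbelianGroup c d) (S : Extension G X) where
  private
    module G = AbelianGroup G
    module X = AbelianGroup X
    open Extension S
    module Eᴾ = AbelianGroupProperties E
    module ι = GroupMorphisms.IsGroupMonomorphism ι-mono
    module π = GroupMorphisms.IsGroupHomomorphism π-homo

  Retraction : Set _
  Retraction = Σ (E.Carrier → X.Carrier) λ r →
    GroupMorphisms.IsGroupHomomorphism E.rawGroup X.rawGroup r × (∀ x → r (ι x) X.≈ x)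

  isSplit⇒retraction : _≅_ G X S (split G X) → Retraction
  isSplit⇒retraction S≅split = (λ e → proj₁ (to e)) ,
    isGroupHomomorphism E X _ (λ x≈y → proj₁ (to.⟦⟧-cong x≈y)) (λ x y → proj₁ (to.∙-homo x y)) ,
    λ x → proj₁ (to-ι x)
    where
    open _≅_ S≅split
    module to = GroupMorphisms.IsGroupIsomorphism to-iso

  π∘ι : ∀ x → π (ι x) G.≈ G.ε
  π∘ι x = Equivalence.from (exact (ι x)) (x , E.refl)

  retraction⇒isSplit : Retraction → _≅_ G X S (split G X)
  retraction⇒isSplit (r , r-homo , r-ι) = record
    { to     = λ e → r e , π e
    ; to-iso = record
      { isGroupMonomorphism = record
        { isGroupHomomorphism = isGroupHomomorphism E (DirectProduct.abelianGroup X G) _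
            (λ p → r.⟦⟧-cong p , π.⟦⟧-cong p) (λ x y → r.homo x y , π.homo x y)
        ; injective = λ {x} {y} (rx≈ry , πx≈πy) → injective rx≈ry
            (Equivalence.to (exact (x E.∙ y E.⁻¹))
              (G.trans (π.homo x _) (G.trans (G.∙-cong πx≈πy (π.⁻¹-homo y)) (G.inverseʳ (π y)))))
        }
      ; surjective = λ (x , g) → let e , πe≈g = π-surjective g in
          -- Correcting a lift of `g` by an element of the image of `ι` moves its retraction to `x`
          -- and leaves its image under `π` unchanged.
          e E.∙ ι (x X.∙ r e X.⁻¹) , λ {z} z≈ →
            X.trans (r.⟦⟧-cong z≈) (X.trans (r.homo _ _) (X.trans (X.∙-congˡ (r-ι _)) (cancel x (r e))))
          , G.trans (π.⟦⟧-cong z≈) (G.trans (π.homo _ _)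
              (G.trans (G.∙-cong (πe≈g E.refl) (π∘ι _)) (G.identityʳ g)))
      }
    ; to-ι   = λ x → r-ι x , π∘ι x
    ; π-to   = λ e → G.refl
    }
    where
    module r = GroupMorphisms.IsGroupHomomorphism r-homo
    open IntegerMultiples X using (linear; _⊕_; _⊝_)

    cancel : ∀ x y → y X.∙ (x X.∙ y X.⁻¹) X.≈ x
    cancel x y = linear [] (x ∷ y ∷ []) (λ x y → y ⊕ (x ⊝ y) , x) (≡.refl , ≡.refl , _)

    injective : ∀ {x y} → r x X.≈ r y → ∃[ z ] ι z E.≈ x E.∙ y E.⁻¹ → x E.≈ y
    injective {x} {y} rx≈ry (z , ιz≈) = Eᴾ.∙-cancelʳ (y E.⁻¹) x y
      (E.trans (E.sym ιz≈) (E.trans (ι.⟦⟧-cong z≈ε) (E.trans ι.ε-homo (E.sym (E.inverseʳ y)))))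
      where
      z≈ε : z X.≈ X.ε
      z≈ε = X.trans (X.sym (r-ι z)) (X.trans (r.⟦⟧-cong ιz≈)
        (X.trans (r.homo _ _) (X.trans (X.∙-cong rx≈ry (r.⁻¹-homo y)) (X.inverseʳ (r y)))))

  private
    module Eᵐ = IntegerMultiples E
    module Xᵐ = IntegerMultiples X

  -- Purity of the image of `ι` as a subgroup of `E`.
  Pure : Set _
  Pure = ∀ n x f → ι x E.≈ + suc n Eᵐ.· f → ∃[ w ] x X.≈ + suc n Xᵐ.· w

  module _ (choice : ∀ {a b c d} → AxiomOfChoice a b c d) where
    open Classical choice
    open PartialHom choice E X
    open Subsets (E.Carrier × X.Carrier)

    -- The inverse of `ι` on its image; a homomorphism on all of `E` that extends it is a
    -- retraction.
    graph : Subset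
    graph (e , x) = ⟪ ι x E.≈ e ⟫

    graph-isPartialHom : Pure → IsPartialHom graph
    graph-isPartialHom pure = record
      { resp      = λ e≈ x≈ r → ⟪⟫-intro
          (E.trans (ι.⟦⟧-cong (X.sym x≈)) (E.trans (⟪⟫-elim r) e≈))
      ; ε-closed  = ⟪⟫-intro ι.ε-homo
      ; ∙-closed  = λ r r′ → ⟪⟫-intro (E.trans (ι.∙-homo _ _) (E.∙-cong (⟪⟫-elim r) (⟪⟫-elim r′)))
      ; ⁻¹-closed = λ r → ⟪⟫-intro (E.trans (ι.⁻¹-homo _) (E.⁻¹-cong (⟪⟫-elim r)))
      ; preserves-multiples = λ
          { zero f r e≈ε → X.ε ,
              ι.injective (E.trans (⟪⟫-elim r) (E.trans e≈ε (E.sym ι.ε-homo)))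
          ; (suc n) f r e≈nf → pure n _ f (E.trans (⟪⟫-elim r) e≈nf)
          }
      }

    pure⇒isSplit : Pure → (∀ {R} → graph ⊆ R → IsMaximal R → Total R) → _≅_ G X S (split G X)
    pure⇒isSplit pure maximal⇒total = retraction⇒isSplit
      ( (λ e → proj₁ (total e)) , total⇒hom isPartialHom total
      , λ x → functional (proj₂ (total (ι x))) (graph⊆R _ (⟪⟫-intro E.refl)))
      where
      R⊇graph = extendToMaximal (graph-isPartialHom pure)
      graph⊆R = proj₁ (proj₂ R⊇graph)
      total = maximal⇒total graph⊆R (proj₂ (proj₂ R⊇graph))
      open IsMaximal (proj₂ (proj₂ R⊇graph))

module _ (choice : ∀ {a b c d} → AxiomOfChoice a b c d) where
  open Classical choice

  module _ (E : AbelianGroup a b) (D : AbelianGroup c d) (divisible : Divisible D) where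
    private
      module E where
        open AbelianGroup E public
        open IntegerMultiples E public
        open AbelianGroupProperties E public
      module D where
        open AbelianGroup D public
        open IntegerMultiples D public
        open AbelianGroupProperties D public
    open PartialHom choice E D
    open Subsets (E.Carrier × D.Carrier)

    -- In a divisible group, preserving multiples is automatic for positive `n`. For `n = 0` it asks
    -- that the value chosen at `x` match `R` at every multiple of `x` in the domain.
    divisible⇒total : ∀ {R} → IsMaximal R → Total R
    divisible⇒total {R} max x = proj₁ y , adjoin x (proj₁ y) λ
      { zero k f r s+kx≈ε → D.ε , D.trans (D.∙-congˡ (D.sym (proj₂ y k
          (resp (E.sym (E.inverseʳ-unique _ _ s+kx≈ε)) D.refl (⁻¹-closed r))))) (D.inverseʳ _)
      ; (suc n) k f r s+kx≈nf → let w , nw≈ = divisible n _ in w , D.sym nw≈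
      }
      where
      open IsMaximal max
      Multiple : ℕ → Set _
      Multiple k = ∃[ m ] (+ suc k E.· x , m) ∈ R

      -- The `k` with `k · x` in the domain form an ideal of ℤ. The value at its least positive
      -- element `suc k₀` determines the others, so `y` is a quotient of that value by `suc k₀`. If
      -- the ideal is zero, any value would do.
      value : Dec (∃[ k ] Multiple k) → ∃[ y ] ∀ k {m} → (k E.· x , m) ∈ R → m D.≈ k D.· y
      value (no none) = D.ε , λ
        { (+ zero)  r → ε-functional r E.refl
        ; (+ suc k) r → contradiction (k , _ , r) none
        ; -[1+ k ]  r → contradiction (k , _ , resp (E.⁻¹-involutive _) D.refl (⁻¹-closed r)) none
        }
      value (yes (k , multiple)) with least Multiple k multiple
      ... | k₀ , (m₀ , r₀) , smaller = y , λ k {m} r →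
              let q = k ℤ./ℕ suc k₀ in D.trans (m≈qm₀ k r) (D.trans (D.·-congˡ q (D.sym n₀y≈m₀))
                (D.trans (D.sym (D.*-· q n₀ y)) (D.·-congʳ y (≡.sym (k≡qn₀ k r)))))
        where
        n₀ = + suc k₀
        y = proj₁ (divisible k₀ m₀)
        n₀y≈m₀ = proj₂ (divisible k₀ m₀)

        -- The remainder of `k` modulo `suc k₀` also takes `x` into the domain, so it is zero by the
        -- choice of `k₀`.
        k≡qn₀ : ∀ k {m} → (k E.· x , m) ∈ R → k ≡ k ℤ./ℕ suc k₀ ℤ.* n₀
        k≡qn₀ k r with k ℤ.%ℕ suc k₀ | ℤ.n%ℕd<d k (suc k₀) | ℤ.a≡a%ℕn+[a/ℕn]*n k (suc k₀)
        ... | zero  | _     | k≡ = ≡.trans k≡ (ℤ.+-identityˡ _)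
        ... | suc j | j<k₀  | k≡ = contradiction (_ , resp difference D.refl
                (∙-closed r (⁻¹-closed (·-closed (k ℤ./ℕ suc k₀) r₀)))) (smaller j (ℕ.s≤s⁻¹ j<k₀))
          where
          difference : k E.· x E.∙ ((k ℤ./ℕ suc k₀) E.· (n₀ E.· x)) E.⁻¹ E.≈ + suc j E.· x
          difference = let q = k ℤ./ℕ suc k₀ in
            E.trans (E.∙-congʳ (E.·-congʳ x k≡)) (E.linear (q ∷ n₀ ∷ + suc j ∷ []) (x ∷ [])
              (λ q n j x → (j :+ q :* n) E.⊙ x E.⊝ q E.⊙ (n E.⊙ x) , j E.⊙ x) (≡.refl , _))

        m≈qm₀ : ∀ k {m} → (k E.· x , m) ∈ R → m D.≈ (k ℤ./ℕ suc k₀) D.· m₀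
        m≈qm₀ k r = let q = k ℤ./ℕ suc k₀ in functional r
          (resp (E.trans (E.sym (E.*-· q n₀ x)) (E.·-congʳ x (≡.sym (k≡qn₀ k r)))) D.refl (·-closed q r₀))

      y = value (lem _)

  divisible⇒⊥ : (D : AbelianGroup c d) → Divisible D → (G : AbelianGroup a b) → (⊥ D) G
  divisible⇒⊥ D divisible G S = pure⇒isSplit choice
    (λ n x _ _ → let w , nw≈x = divisible n x in w , AbelianGroup.sym D nw≈x)
    (λ _ → divisible⇒total (Extension.E S) D divisible)
    where open Splitting G D S

-- Bézout coefficients

pos-+* : ∀ {g} a b c d → g ℕ.+ a ℕ.* b ≡ c ℕ.* d → + g ℤ.+ + a ℤ.* + b ≡ + c ℤ.* + d
pos-+* {g} a b c d eq = ≡.trans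
  (≡.sym (≡.trans (ℤ.pos-+ g (a ℕ.* b)) (≡.cong (ℤ._+_ (+ g)) (ℤ.pos-* a b))))
  (≡.trans (≡.cong +_ eq) (ℤ.pos-* c d))

-- Bézout's identity for the quotients makes `g` the greatest common divisor of `d` and `k`.
record CoprimeFactors (d : ℕ) (k : ℤ) : Set where
  field
    g d′   : ℕ
    k′ α β : ℤ
    d≡     : + d ≡ + d′ ℤ.* + g
    k≡     : k ≡ k′ ℤ.* + g
    bézout : α ℤ.* + d′ ℤ.+ β ℤ.* k′ ≡ + 1

  d′-nonZero : .{{NonZero d}} → NonZero d′
  d′-nonZero = ℕ.≢-nonZero λ d′≡0 → ℕ.≢-nonZero⁻¹ d
    (ℤ.+-injective (≡.trans d≡ (≡.cong (λ z → + z ℤ.* + g) d′≡0)))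

  g-nonZero : .{{NonZero d}} → NonZero g
  g-nonZero = ℕ.≢-nonZero λ g≡0 → ℕ.≢-nonZero⁻¹ d
    (ℤ.+-injective (≡.trans d≡ (≡.trans (≡.cong (λ z → + d′ ℤ.* + z) g≡0) (ℤ.*-zeroʳ (+ d′)))))

coprimeFactors : ∀ d k .{{_ : NonZero d}} → CoprimeFactors d k
coprimeFactors d (+ e) = record
  { g = g ; d′ = d′ ; k′ = + e′ ; α = proj₁ coefficients ; β = proj₁ (proj₂ coefficients)
  ; d≡ = pd ; k≡ = pe ; bézout = ℤ.*-cancelʳ-≡ _ _ (+ g) (proj₂ (proj₂ coefficients)) }
  where
  g = ℕ.gcd d e
  instance
    g≢0 : NonZero g
    g≢0 = ℕ.≢-nonZero λ g≡0 → ℕ.≢-nonZero⁻¹ d (ℕ.gcd[m,n]≡0⇒m≡0 g≡0)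
  d′ = ℕ.quotient (ℕ.gcd[m,n]∣m d e)
  e′ = ℕ.quotient (ℕ.gcd[m,n]∣n d e)
  pd : + d ≡ + d′ ℤ.* + g
  pd = ≡.trans (≡.cong +_ (ℕ._∣_.equality (ℕ.gcd[m,n]∣m d e))) (ℤ.pos-* d′ g)
  pe : + e ≡ + e′ ℤ.* + g
  pe = ≡.trans (≡.cong +_ (ℕ._∣_.equality (ℕ.gcd[m,n]∣n d e))) (ℤ.pos-* e′ g)

  isolate : ∀ x y d′ e′ g → g ℤ.+ y ℤ.* (e′ ℤ.* g) ≡ x ℤ.* (d′ ℤ.* g) →
    (x ℤ.* d′ ℤ.- y ℤ.* e′) ℤ.* g ≡ + 1 ℤ.* g
  isolate x y d′ e′ g eq = ≡.trans (lhs x y d′ e′ g)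
    (≡.trans (≡.cong (ℤ._- y ℤ.* (e′ ℤ.* g)) (≡.sym eq)) (rhs g (y ℤ.* (e′ ℤ.* g))))
    where
    lhs : ∀ x y d′ e′ g → (x ℤ.* d′ ℤ.- y ℤ.* e′) ℤ.* g ≡ x ℤ.* (d′ ℤ.* g) ℤ.- y ℤ.* (e′ ℤ.* g)
    lhs = solve-∀
    rhs : ∀ g z → (g ℤ.+ z) ℤ.- z ≡ + 1 ℤ.* g
    rhs = solve-∀

  coefficients : ∃[ α ] ∃[ β ] (α ℤ.* + d′ ℤ.+ β ℤ.* + e′) ℤ.* + g ≡ + 1 ℤ.* + g
  coefficients with ℕ.Bézout.identity (ℕ.gcd-GCD d e)
  ... | ℕ.Bézout.+- x y eq = + x , ℤ.- + y , ≡.trans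
          (≡.cong (λ z → (+ x ℤ.* + d′ ℤ.+ z) ℤ.* + g) (≡.sym (ℤ.neg-distribˡ-* (+ y) (+ e′))))
          (isolate (+ x) (+ y) (+ d′) (+ e′) (+ g) (≡.subst₂ (λ m n → + g ℤ.+ + y ℤ.* n ≡ + x ℤ.* m)
            pd pe (pos-+* y e x d eq)))
  ... | ℕ.Bézout.-+ x y eq = ℤ.- + x , + y , ≡.trans
          (flip (+ x) (+ y) (+ d′) (+ e′) (+ g))
          (isolate (+ y) (+ x) (+ e′) (+ d′) (+ g) (≡.subst₂ (λ m n → + g ℤ.+ + x ℤ.* n ≡ + y ℤ.* m)
            pe pd (pos-+* x d y e eq)))
    where
    flip : ∀ x y d′ e′ g → (ℤ.- x ℤ.* d′ ℤ.+ y ℤ.* e′) ℤ.* g ≡ (y ℤ.* e′ ℤ.- x ℤ.* d′) ℤ.* g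
    flip = solve-∀
coprimeFactors d -[1+ e ] = record
  { g = g ; d′ = d′ ; k′ = ℤ.- k′ ; α = α ; β = ℤ.- β ; d≡ = d≡
  ; k≡ = ≡.trans (≡.cong ℤ.-_ k≡) (ℤ.neg-distribˡ-* k′ (+ g))
  ; bézout = ≡.trans (≡.cong (λ z → α ℤ.* + d′ ℤ.+ z) (neg-neg β k′)) bézout
  }
  where
  open CoprimeFactors (coprimeFactors d (+ suc e))
  neg-neg : ∀ x y → ℤ.- x ℤ.* ℤ.- y ≡ x ℤ.* y
  neg-neg = solve-∀

-- The greatest common divisor of `p` and `k` divides `p`, so it is 1 or `p`.
prime∣-or-coprime : ∀ {p} → Prime p → ∀ k →
  (∃[ q ] k ≡ q ℤ.* + p) ⊎ (∃[ α ] ∃[ β ] α ℤ.* + p ℤ.+ β ℤ.* k ≡ + 1)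
prime∣-or-coprime {p} p-prime k = decide (prime⇒irreducible p-prime
    (ℕ.divides d′ (ℤ.+-injective (≡.trans d≡ (≡.sym (ℤ.pos-* d′ g))))))
  where
  open CoprimeFactors (coprimeFactors p k {{prime⇒nonZero p-prime}})
  decide : g ≡ 1 ⊎ g ≡ p →
    (∃[ q ] k ≡ q ℤ.* + p) ⊎ (∃[ α ] ∃[ β ] α ℤ.* + p ℤ.+ β ℤ.* k ≡ + 1)
  decide (inj₂ g≡p) = inj₁ (k′ , ≡.trans k≡ (≡.cong (λ z → k′ ℤ.* + z) g≡p))
  decide (inj₁ g≡1) = inj₂ (α , β , ≡.subst₂ (λ x y → α ℤ.* x ℤ.+ β ℤ.* y ≡ + 1)
      (≡.sym (drop-g d≡)) (≡.sym (drop-g k≡)) bézout)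
    where
    drop-g : ∀ {x y} → x ≡ y ℤ.* + g → x ≡ y
    drop-g {y = y} x≡ = ≡.trans x≡ (≡.trans (≡.cong (λ z → y ℤ.* + z) g≡1) (ℤ.*-identityʳ y))

-- Extensions by groups that solve systems of congruences

TorsionFree : AbelianGroup a b → Set (a ⊔ b)
TorsionFree A = ∀ n x → + suc n · x ≈ ε → x ≈ ε
  where
  open AbelianGroup A
  open IntegerMultiples A

-- A system of congruences y ≡ m mod eM on one unknown y, closed under
-- consequences and free of contradictions.
record CongruenceSystem (M : AbelianGroup a b) : Set (lsuc 0ℓ ⊔ a ⊔ b) where
  open AbelianGroup M
  open IntegerMultiples M
  field
    Congruence : ℕ → Carrier → Set
    resp       : ∀ {e m m′} → m ≈ m′ → Congruence e m → Congruence e m′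
    nonZero    : ∀ {e m} → Congruence e m → NonZero e
    consistent : ∀ {e m m′} → Congruence e m → Congruence e m′ → ∃[ w ] m ∙ m′ ⁻¹ ≈ + e · w
    trivial    : Congruence 1 ε
    weaken     : ∀ {d e m} → + d ℤ.∣ + e → Congruence e m → Congruence d m
    combine    : ∀ {d e m m′} → Congruence d m → Congruence e m′ →
      ∃[ n ] ∃[ m″ ] + d ℤ.∣ + n × + e ℤ.∣ + n × Congruence n m″

-- Algebraic compactness, limited to congruences in one unknown.
Complete : AbelianGroup a b → Set _
Complete M = (C : CongruenceSystem M) →
  ∃[ y ] ∀ e m → CongruenceSystem.Congruence C e m → ∃[ w ] y ∙ m ⁻¹ ≈ + e · w
  where
  open AbelianGroup M
  open IntegerMultiples M

module _ (choice : ∀ {a b c d} → AxiomOfChoice a b c d) where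
  open Classical choice

  module _ (E : AbelianGroup a b) (M : AbelianGroup c d)
    (torsionFree : TorsionFree M) (complete : Complete M) where
    private
      module E where
        open AbelianGroup E public
        open IntegerMultiples E public
        open AbelianGroupProperties E public
      module M where
        open AbelianGroup M public
        open IntegerMultiples M public
        open AbelianGroupProperties M public
    open PartialHom choice E M
    open Subsets (E.Carrier × M.Carrier)

    module _ {R : Subset} (max : IsMaximal R) where
      open IsMaximal max renaming (resp to R-resp)

      private
        InDomain : E.Carrier → Set _
        InDomain x = ∃[ m ] (x , m) ∈ R

      -- The value at x is forced to be the quotient by suc k₀ of the value at suc k₀ · x.
      domain-pure : ∀ k₀ x → InDomain (+ suc k₀ E.· x) → InDomain x
      domain-pure k₀ x (m , kx∈) with preserves-multiples (suc k₀) x kx∈ E.refl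
      ... | y , m≈ky = y , adjoin x y multiple
        where
        k = + suc k₀
        multiple : ∀ n j {s m′} f → (s , m′) ∈ R → s E.∙ j E.· x E.≈ + n E.· f →
          ∃[ w ] m′ M.∙ j M.· y M.≈ + n M.· w
        -- Multiplication by `k` brings the equation into the domain, where `R` preserves
        -- divisibility by `k n`; torsion-freeness of `M` cancels `k` again.
        multiple n j {s} {m′} f r eq with preserves-multiples (suc k₀ ℕ.* n) f
          (∙-closed (·-closed k r) (·-closed j kx∈))
          (E.trans (E.linear (k ∷ j ∷ []) (s ∷ x ∷ []) (λ k j s x →
              k E.⊙ s E.⊕ j E.⊙ (k E.⊙ x) , k E.⊙ (s E.⊕ j E.⊙ x)) (≡.refl , ≡.refl , _))
            (E.trans (E.·-congˡ k eq) (E.trans (E.sym (E.*-· k (+ n) f))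
              (E.·-congʳ f (≡.sym (ℤ.pos-* (suc k₀) n))))))
        ... | w , eq′ = w , M.x∙y⁻¹≈ε⇒x≈y _ _ (torsionFree k₀ _ (M.trans
              (M.linear (k ∷ j ∷ + n ∷ []) (m′ ∷ y ∷ w ∷ []) (λ k j n m y w →
                k M.⊙ (m M.⊕ j M.⊙ y M.⊝ n M.⊙ w) , (k M.⊙ m M.⊕ j M.⊙ (k M.⊙ y)) M.⊝ (k :* n) M.⊙ w)
                (≡.refl , ≡.refl , ≡.refl , _))
              (M.x≈y⇒x∙y⁻¹≈ε (M.trans (M.∙-congˡ (M.·-congˡ j (M.sym m≈ky)))
                (M.trans eq′ (M.·-congʳ w (ℤ.pos-* (suc k₀) n)))))))

      module _ (x : E.Carrier) (x∉ : ¬ InDomain x) where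

        -- If `x` is congruent modulo `e` to a domain element with value `m`, then preservation of
        -- multiples forces the value at `x` to be congruent to `m`. These necessary conditions form
        -- the system.
        congruences : CongruenceSystem M
        congruences = record
          { Congruence = λ e m → T ⟪ (NonZero e × ∃[ s ] ∃[ f ] (s , m) ∈ R × x E.∙ s E.⁻¹ E.≈ + e E.· f) ⟫
          ; resp       = λ m≈ p → let e≢0 , s , f , r , eq = ⟪⟫-elim p in
              ⟪⟫-intro (e≢0 , s , f , R-resp E.refl m≈ r , eq)
          ; nonZero    = λ p → proj₁ (⟪⟫-elim p)
          ; consistent = λ {e} p p′ → let
                _ , s , f , r , eq = ⟪⟫-elim p
                _ , s′ , f′ , r′ , eq′ = ⟪⟫-elim p′
              in preserves-multiples e (f′ E.∙ f E.⁻¹) (∙-closed r (⁻¹-closed r′))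
                (E.trans (E.linear [] (x ∷ s ∷ s′ ∷ []) (λ x s s′ →
                    s E.⊝ s′ , (x E.⊝ s′) E.⊝ (x E.⊝ s)) (≡.refl , ≡.refl , ≡.refl , _))
                  (E.trans (E.∙-cong eq′ (E.⁻¹-cong eq))
                    (E.linear (+ e ∷ []) (f ∷ f′ ∷ []) (λ e f f′ →
                      e E.⊙ f′ E.⊝ e E.⊙ f , e E.⊙ (f′ E.⊝ f)) (≡.refl , ≡.refl , _))))
          ; trivial    = ⟪⟫-intro (_ , E.ε , x , ε-closed
              , E.linear [] (x ∷ []) (λ x → x E.⊝ E.𝟘 , con (+ 1) E.⊙ x) (≡.refl , _))
          ; weaken     = λ { {d} {e} (ℤ.divides q e≡qd) p → let e≢0 , s , f , r , eq = ⟪⟫-elim p in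
              ⟪⟫-intro (divisor-nonZero q e≡qd e≢0 , s , q E.· f , r
                , E.trans eq (E.trans (E.·-congʳ f (≡.trans e≡qd (ℤ.*-comm q (+ d)))) (E.*-· (+ d) q f))) }
          ; combine    = λ {d} {e} p p′ → combine {d} {e} (⟪⟫-elim p) (⟪⟫-elim p′)
          }
          where
          divisor-nonZero : ∀ {d e} q → + e ≡ q ℤ.* + d → NonZero e → NonZero d
          divisor-nonZero {zero}  {e} q e≡ e≢0 =
            contradiction (ℤ.+-injective (≡.trans e≡ (ℤ.*-zeroʳ q))) (ℕ.≢-nonZero⁻¹ e {{e≢0}})
          divisor-nonZero {suc d} q e≡ e≢0 = _

          -- Chinese remaindering: with `d = d′ g`, `e = k′ g` and `α d′ + β k′ = 1`, the element
          -- `β k′ s + α d′ s′` is congruent to `x` modulo `d′ e`, a common multiple of `d` and `e`.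
          combine : ∀ {d e m m′} →
            NonZero d × (∃[ s ] ∃[ f ] (s , m) ∈ R × x E.∙ s E.⁻¹ E.≈ + d E.· f) →
            NonZero e × (∃[ s ] ∃[ f ] (s , m′) ∈ R × x E.∙ s E.⁻¹ E.≈ + e E.· f) →
            ∃[ n ] ∃[ m″ ] + d ℤ.∣ + n × + e ℤ.∣ + n ×
              T ⟪ (NonZero n × ∃[ s ] ∃[ f ] (s , m″) ∈ R × x E.∙ s E.⁻¹ E.≈ + n E.· f) ⟫
          combine {d} {e} (d≢0 , s , f , r , eq) (e≢0 , s′ , f′ , r′ , eq′) =
            d′ ℕ.* e , _ , ℤ.divides k′ (≡.trans n≡ (swap (+ d′) k′ (+ g) d≡))
            , ℤ.divides (+ d′) (ℤ.pos-* d′ e)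
            , ⟪⟫-intro
              ( ℕ.m*n≢0 d′ e {{d′-nonZero {{d≢0}}}} {{e≢0}}
              , _ , β E.· f E.∙ α E.· f′
              , ∙-closed (·-closed (β ℤ.* k′) r) (·-closed (α ℤ.* + d′) r′)
              , E.trans (E.∙-congʳ (E.trans (E.sym (E.·-identity x)) (E.·-congʳ x (≡.sym bézout))))
                (E.trans (E.linear (α ∷ β ∷ + d′ ∷ k′ ∷ []) (x ∷ s ∷ s′ ∷ []) (λ α β d k x s s′ →
                    (α :* d :+ β :* k) E.⊙ x E.⊝ ((β :* k) E.⊙ s E.⊕ (α :* d) E.⊙ s′) ,
                    (β :* k) E.⊙ (x E.⊝ s) E.⊕ (α :* d) E.⊙ (x E.⊝ s′)) (≡.refl , ≡.refl , ≡.refl , _))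
                (E.trans (E.∙-cong (E.·-congˡ (β ℤ.* k′) (E.trans eq (E.·-congʳ f d≡)))
                                   (E.·-congˡ (α ℤ.* + d′) (E.trans eq′ (E.·-congʳ f′ k≡))))
                (E.trans (E.linear (α ∷ β ∷ + d′ ∷ k′ ∷ + g ∷ []) (f ∷ f′ ∷ []) (λ α β d k g f f′ →
                    (β :* k) E.⊙ ((d :* g) E.⊙ f) E.⊕ (α :* d) E.⊙ ((k :* g) E.⊙ f′) ,
                    (d :* (k :* g)) E.⊙ (β E.⊙ f E.⊕ α E.⊙ f′)) (≡.refl , ≡.refl , _))
                (E.·-congʳ _ (≡.sym n≡))))))
            where
            open CoprimeFactors (coprimeFactors d (+ e) {{d≢0}})
            n≡ : + (d′ ℕ.* e) ≡ + d′ ℤ.* (k′ ℤ.* + g)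
            n≡ = ≡.trans (ℤ.pos-* d′ e) (≡.cong (+ d′ ℤ.*_) k≡)
            swap : ∀ d′ k′ g {d} → d ≡ d′ ℤ.* g → d′ ℤ.* (k′ ℤ.* g) ≡ k′ ℤ.* d
            swap d′ k′ g ≡.refl = lemma d′ k′ g
              where
              lemma : ∀ d′ k′ g → d′ ℤ.* (k′ ℤ.* g) ≡ k′ ℤ.* (d′ ℤ.* g)
              lemma = solve-∀

        private
          y = proj₁ (complete congruences)
          y-solves = proj₂ (complete congruences)

        -- By `domain-pure`, a nonzero multiple of `x` in the domain would put `x` there.
        multiple-∉ : ∀ k {s m} → (s , m) ∈ R → s E.∙ k E.· x E.≈ E.ε → k ≡ + 0
        multiple-∉ (+ zero)  r eq = ≡.refl
        multiple-∉ (+ suc k) r eq = contradiction (domain-pure k x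
          (_ , R-resp (E.sym (E.inverseʳ-unique _ _ eq)) M.refl (⁻¹-closed r))) x∉
        multiple-∉ -[1+ k ]  r eq = contradiction (domain-pure k x
          (_ , R-resp (E.x∙y⁻¹≈ε⇒x≈y _ _ eq) M.refl r)) x∉

        -- Dividing s + kx = (suc N)f by gcd(suc N , k) makes k invertible modulo the
        -- new modulus, so that the divisibility becomes one of the congruences for x.
        multiple-new : ∀ N k {s m} f → (s , m) ∈ R → s E.∙ k E.· x E.≈ + N E.· f →
          ∃[ w ] m M.∙ k M.· y M.≈ + N M.· w
        multiple-new zero k {s} {m} f r eq = M.ε , M.trans
          (M.∙-congˡ (M.·-congʳ y k≡0)) (M.trans (M.identityʳ m) (ε-functional r
            (E.trans (E.sym (E.identityʳ s)) (E.trans (E.∙-congˡ (E.·-congʳ x (≡.sym k≡0))) eq))))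
          where k≡0 = multiple-∉ k r eq
        multiple-new N@(suc _) k {s} {m} f r eq = α M.· m′ M.∙ k′ M.· w ,
            M.trans (M.∙-cong m≈gm′ (M.·-congʳ y k≡))
            (M.trans (M.linear (k′ ∷ + g ∷ []) (m′ ∷ y ∷ []) (λ k g m y →
                g M.⊙ m M.⊕ (k :* g) M.⊙ y , g M.⊙ (con (+ 1) M.⊙ m M.⊕ k M.⊙ y)) (≡.refl , ≡.refl , _))
            (M.trans (M.·-congˡ (+ g) (M.∙-congʳ (M.·-congʳ m′ (≡.sym bézout))))
            (M.trans (M.linear (α ∷ β ∷ + d′ ∷ k′ ∷ + g ∷ []) (m′ ∷ y ∷ []) (λ α β d k g m y →
                g M.⊙ ((α :* d :+ β :* k) M.⊙ m M.⊕ k M.⊙ y) ,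
                g M.⊙ (k M.⊙ (y M.⊝ (:- β) M.⊙ m) M.⊕ (α :* d) M.⊙ m)) (≡.refl , ≡.refl , _))
            (M.trans (M.·-congˡ (+ g) (M.∙-congʳ (M.·-congˡ k′ y-solved)))
            (M.trans (M.linear (α ∷ + d′ ∷ k′ ∷ + g ∷ []) (m′ ∷ w ∷ []) (λ α d k g m w →
                g M.⊙ (k M.⊙ (d M.⊙ w) M.⊕ (α :* d) M.⊙ m) ,
                (d :* g) M.⊙ (α M.⊙ m M.⊕ k M.⊙ w)) (≡.refl , ≡.refl , _))
            (M.·-congʳ _ (≡.sym d≡)))))))
          where
          open CoprimeFactors (coprimeFactors N k)

          -- A quotient of `s` by `g` in `E`; it lies in the domain because the domain is pure.
          t : E.Carrier
          t = + d′ E.· f E.∙ (k′ E.· x) E.⁻¹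

          gt≈s : + g E.· t E.≈ s
          gt≈s = E.trans (E.linear (+ d′ ∷ k′ ∷ + g ∷ []) (f ∷ x ∷ []) (λ d k g f x →
              g E.⊙ (d E.⊙ f E.⊝ k E.⊙ x) , (d :* g) E.⊙ f E.⊝ (k :* g) E.⊙ x) (≡.refl , ≡.refl , _))
            (E.trans (E.∙-cong (E.·-congʳ f (≡.sym d≡)) (E.⁻¹-cong (E.·-congʳ x (≡.sym k≡))))
            (E.trans (E.∙-congʳ (E.sym eq))
              (E.linear (k ∷ []) (s ∷ x ∷ []) (λ k s x → (s E.⊕ k E.⊙ x) E.⊝ k E.⊙ x , s)
                (≡.refl , ≡.refl , _))))

          t∈ : ∀ g → NonZero g → + g E.· t E.≈ s → InDomain t
          t∈ (suc g) _ gt≈s = domain-pure g t (m , R-resp (E.sym gt≈s) M.refl r)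

          m′ = proj₁ (t∈ g g-nonZero gt≈s)
          tm′∈ = proj₂ (t∈ g g-nonZero gt≈s)

          m≈gm′ : m M.≈ + g M.· m′
          m≈gm′ = functional r (R-resp gt≈s M.refl (·-closed (+ g) tm′∈))

          -- From `α d′ + β k′ = 1` follows `x + β t = d′ (β f + α x)`, so `x` is congruent to
          -- `- β t` modulo `d′`.
          solution = y-solves d′ (ℤ.- β M.· m′) (⟪⟫-intro
            ( d′-nonZero , ℤ.- β E.· t , β E.· f E.∙ α E.· x , ·-closed (ℤ.- β) tm′∈
            , E.trans (E.∙-congʳ (E.trans (E.sym (E.·-identity x)) (E.·-congʳ x (≡.sym bézout))))
              (E.linear (α ∷ β ∷ + d′ ∷ k′ ∷ []) (f ∷ x ∷ []) (λ α β d k f x →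
                (α :* d :+ β :* k) E.⊙ x E.⊝ (:- β) E.⊙ (d E.⊙ f E.⊝ k E.⊙ x) ,
                d E.⊙ (β E.⊙ f E.⊕ α E.⊙ x)) (≡.refl , ≡.refl , _)) ))
          w = proj₁ solution
          y-solved = proj₂ solution

      complete⇒total : Total R
      complete⇒total x with lem (InDomain x)
      ... | yes x∈ = x∈
      ... | no  x∉ = _ , adjoin x _ (multiple-new x x∉)

  torsionFree⇒⊥ : (M : AbelianGroup c d) → TorsionFree M → Complete M →
    (G : AbelianGroup a b) → TorsionFree G → (⊥ M) G
  torsionFree⇒⊥ M torsionFree complete G G-torsionFree S = pure⇒isSplit choice pure
    λ _ → complete⇒total E M torsionFree complete
    where
    open Splitting G M S
    open Extension S
    module G = AbelianGroup G
    module Eᵐ = IntegerMultiples E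
    module Mᵐ = IntegerMultiples M
    module ι = GroupMorphisms.IsGroupMonomorphism ι-mono
    module π = GroupMorphisms.IsGroupHomomorphism π-homo

    -- If a positive multiple of `f` lies in the image of `ι`, then `π f` is torsion, hence zero,
    -- and exactness puts `f` in that image.
    pure : Pure
    pure n x f ιx≈nf = w , ι.injective (E.trans ιx≈nf (E.trans (Eᵐ.·-congˡ (+ suc n) (E.sym ιw≈f))
        (E.sym (·-homo M E ι.isGroupHomomorphism (+ suc n) w))))
      where
      f∈ι : ∃[ w ] ι w E.≈ f
      f∈ι = Equivalence.to (exact f) (G-torsionFree n (π f) (G.trans
        (G.sym (·-homo E G π-homo (+ suc n) f)) (G.trans (π.⟦⟧-cong (E.sym ιx≈nf)) (π∘ι x))))
      w = proj₁ f∈ι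
      ιw≈f = proj₂ f∈ι

-- Quotients of powers of ℤ

private
  ℤ⁺ : AbelianGroup 0ℓ 0ℓ
  ℤ⁺ = ℤ.+-0-abelianGroup

  module ℤ⁺ = IntegerMultiples ℤ⁺

·≡* : ∀ i n → i ℤ⁺.· n ≡ i ℤ.* n
·≡* (+ k)    n = go k
  where
  go : ∀ k → + k ℤ⁺.· n ≡ + k ℤ.* n
  go zero    = ≡.refl
  go (suc k) = ≡.trans (≡.cong (ℤ._+_ n) (go k)) (≡.sym (ℤ.suc-* (+ k) n))
·≡* -[1+ k ] n = ≡.trans (≡.cong ℤ.-_ (·≡* (+ suc k) n)) (ℤ.neg-distribˡ-* (+ suc k) n)

module _ (A : AbelianGroup a b) (N : Subgroup A p) where
  open AbelianGroup A
  open Subgroup N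
  private
    module A/N = AbelianGroup (A / N)

  quotient-homo : GroupMorphisms.IsGroupHomomorphism rawGroup A/N.rawGroup (λ x → x)
  quotient-homo = isGroupHomomorphism A (A / N) _
    (λ {x} {y} x≈y → resp (sym (trans (∙-congʳ x≈y) (inverseʳ y))) ε-closed)
    (λ x y → A/N.refl {x ∙ y})

module _ (κ : Set a) where
  private
    module ℤ^κ where
      open AbelianGroup (ℤ^ κ) public
      open IntegerMultiples (ℤ^ κ) public

  ·-pointwise : ∀ i f j → (i ℤ^κ.· f) j ≡ i ℤ.* f j
  ·-pointwise i f j = ≡.trans (·-homo (ℤ^ κ) ℤ⁺ evaluation i f) (·≡* i (f j))
    where
    evaluation : GroupMorphisms.IsGroupHomomorphism ℤ^κ.rawGroup (AbelianGroup.rawGroup ℤ⁺) (λ f → f j)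
    evaluation = isGroupHomomorphism (ℤ^ κ) ℤ⁺ _ (λ f≈g → f≈g j) (λ _ _ → ≡.refl)

  module _ (N : Subgroup (ℤ^ κ) p) where
    private
      module Q where
        open AbelianGroup (ℤ^ κ / N) public
        open IntegerMultiples (ℤ^ κ / N) public

    -- Multiples in the quotient can be computed pointwise. The endpoints of such equalities are
    -- written out because membership of a difference does not determine them.
    *≈· : ∀ i (f : κ → ℤ) → (λ j → i ℤ.* f j) Q.≈ i Q.· f
    *≈· i f = Q.trans {λ j → i ℤ.* f j} {i ℤ^κ.· f} {i Q.· f}
      (⟦⟧-cong λ j → ≡.sym (·-pointwise i f j))
      (·-homo (ℤ^ κ) (ℤ^ κ / N) (quotient-homo (ℤ^ κ) N) i f)
      where open GroupMorphisms.IsGroupHomomorphism (quotient-homo (ℤ^ κ) N)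

  ℤ^κ/B-divisible : Divisible (ℤ^ κ / B^<∞ κ)
  ℤ^κ/B-divisible n f = quotient , Q.trans {+ suc n Q.· quotient} {λ j → + suc n ℤ.* quotient j} {f}
      (Q.sym {λ j → + suc n ℤ.* quotient j} {+ suc n Q.· quotient} (*≈· (B^<∞ κ) (+ suc n) quotient))
      (suc n , λ j → ≡.subst (ℕ._≤ suc n) (≡.sym (bound j)) (ℕ.<⇒≤ (ℤ.n%ℕd<d (f j) (suc n))))
    where
    module Q where
      open AbelianGroup (ℤ^ κ / B^<∞ κ) public
      open IntegerMultiples (ℤ^ κ / B^<∞ κ) public
    quotient : κ → ℤ
    quotient j = f j ℤ./ℕ suc n

    bound : ∀ j → ∣ + suc n ℤ.* quotient j ℤ.- f j ∣ ≡ f j ℤ.%ℕ suc n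
    bound j = ≡.trans
      (≡.cong (λ z → ∣ + suc n ℤ.* quotient j ℤ.- z ∣) (ℤ.a≡a%ℕn+[a/ℕn]*n (f j) (suc n)))
      (≡.trans (≡.cong ∣_∣ (remainder (+ suc n) (quotient j) (+ (f j ℤ.%ℕ suc n))))
        (ℤ.∣-i∣≡∣i∣ (+ (f j ℤ.%ℕ suc n))))
      where
      remainder : ∀ d q r → d ℤ.* q ℤ.- (r ℤ.+ q ℤ.* d) ≡ ℤ.- r
      remainder = solve-∀

-- The quotient of ℤ^ω by the direct sum

fresh : (is : List ℕ) → ∃[ i ] i ∉ is
fresh is = suc (foldr ℕ._⊔_ 0 is) , λ i∈ → ℕ.n≮n _ (∈⇒≤ i∈)
  where
  ∈⇒≤ : ∀ {i is} → i ∈ˡ is → i ℕ.≤ foldr ℕ._⊔_ 0 is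
  ∈⇒≤ (here ≡.refl) = ℕ.m≤m⊔n _ _
  ∈⇒≤ {is = j ∷ _} (there i∈) = ℕ.≤-trans (∈⇒≤ i∈) (ℕ.m≤n⊔m j _)

ℤ^ω/ℤ^⟨ω⟩ : AbelianGroup 0ℓ 0ℓ
ℤ^ω/ℤ^⟨ω⟩ = ℤ^ ℕ / ℤ^⟨ ℕ ⟩

private
  module Q where
    open AbelianGroup ℤ^ω/ℤ^⟨ω⟩ public
    open IntegerMultiples ℤ^ω/ℤ^⟨ω⟩ public

ℤ^ω/ℤ^⟨ω⟩-torsionFree : TorsionFree ℤ^ω/ℤ^⟨ω⟩
ℤ^ω/ℤ^⟨ω⟩-torsionFree n f nf≈ε
  with Q.trans {λ j → + suc n ℤ.* f j} {+ suc n Q.· f} {Q.ε} (*≈· ℕ ℤ^⟨ ℕ ⟩ (+ suc n) f) nf≈ε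
... | is , nf≡0 = is , λ i i∉ → ≡.trans (ℤ.+-identityʳ (f i)) (ℤ.*-cancelˡ-≡ (+ suc n) (f i) (+ 0)
        (≡.trans (≡.sym (ℤ.+-identityʳ _)) (≡.trans (nf≡0 i i∉) (≡.sym (ℤ.*-zeroʳ (+ suc n))))))

-- At a coordinate outside the finite exceptional list the equation holds exactly in ℤ.
1-indivisible : ∀ p f → (λ _ → + 1) Q.≈ + p Q.· f → p ≡ 1
1-indivisible p f 1≈pf
  with Q.trans {λ _ → + 1} {+ p Q.· f} {λ j → + p ℤ.* f j} 1≈pf
         (Q.sym {λ j → + p ℤ.* f j} {+ p Q.· f} (*≈· ℕ ℤ^⟨ ℕ ⟩ (+ p) f))
... | is , 1-pf≡0 = let i , i∉ = fresh is in
        ℕ.∣1⇒≡1 (ℤ.∣⇒∣ᵤ (ℤ.divides (f i) (≡.trans (ℤ.i-j≡0⇒i≡j (+ 1) _ (1-pf≡0 i i∉)) (ℤ.*-comm (+ p) (f i)))))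

module _ (choice : ∀ {a b c d} → AxiomOfChoice a b c d) where
  open Classical choice

  -- Stages merge more and more of the congruences into a single one. From coordinate `n` on, the
  -- diagonal agrees with stage `n` modulo its modulus, and finitely many coordinates do not matter.
  ℤ^ω/ℤ^⟨ω⟩-complete : Complete ℤ^ω/ℤ^⟨ω⟩
  ℤ^ω/ℤ^⟨ω⟩-complete system = diagonal , solves
    where
    open CongruenceSystem system

    Stage : Set
    Stage = Σ ℕ λ e → Σ (ℕ → ℤ) (Congruence e)

    modulus : Stage → ℕ
    modulus = proj₁

    value : Stage → ℕ → ℤ
    value s = proj₁ (proj₂ s)

    -- Representatives have to agree at every coordinate, not just at almost all, because the
    -- diagonal reads a single coordinate of each stage.
    Refines : Stage → Stage → Set
    Refines s s′ = + modulus s ℤ.∣ + modulus s′ × (∀ i → + modulus s ℤ.∣ value s′ i ℤ.- value s i)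

    refine : ∀ s d → Dec (∃[ m ] Congruence d m) →
      ∃[ s′ ] Refines s s′ × ((∃[ m ] Congruence d m) → + d ℤ.∣ + modulus s′)
    refine s d (no ∄m) = s , (ℤ.∣-refl , λ i → ℤ.divides (+ 0) (ℤ.+-inverseʳ (value s i)))
                       , λ m → contradiction m ∄m
    refine (e , b , be) d (yes (m , md)) with combine be md
    ... | n , m″ , e∣n , d∣n , m″n with consistent (weaken e∣n m″n) be
    ...   | w , m″-b≈ew =
      -- Another representative of the class of `m″`, chosen to differ from `b` by a multiple of `e`
      -- at every coordinate.
      (n , (λ i → b i ℤ.+ + e ℤ.* w i) , resp {m′ = λ i → b i ℤ.+ + e ℤ.* w i} m″≈ m″n)
      , (e∣n , λ i → ℤ.divides (w i) (shift (b i) (+ e) (w i)))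
      , λ _ → d∣n
      where
      shift : ∀ b e w → (b ℤ.+ e ℤ.* w) ℤ.- b ≡ w ℤ.* e
      shift = solve-∀
      rearrange : ∀ m b z → m ℤ.- (b ℤ.+ z) ≡ (m ℤ.- b) ℤ.- z
      rearrange = solve-∀
      m″≈ : m″ Q.≈ (λ i → b i ℤ.+ + e ℤ.* w i)
      m″≈ with Q.trans {λ i → m″ i ℤ.- b i} {+ e Q.· w} {λ i → + e ℤ.* w i} m″-b≈ew
                 (Q.sym {λ i → + e ℤ.* w i} {+ e Q.· w} (*≈· ℕ ℤ^⟨ ℕ ⟩ (+ e) w))
      ... | is , ≡0 = is , λ i i∉ → ≡.trans (rearrange (m″ i) (b i) (+ e ℤ.* w i)) (≡0 i i∉)

    stage : ℕ → Stage
    stage zero    = 1 , (λ _ → + 0) , trivial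
    -- Stage `suc n` absorbs the modulus `n`, so a congruence modulo `e` is accounted for from stage
    -- `suc e` on.
    stage (suc n) = proj₁ (refine (stage n) n (lem _))

    stage-refines : ∀ n k → Refines (stage n) (stage (k ℕ.+ n))
    stage-refines n zero    =
      ℤ.∣-refl , λ i → ℤ.divides (+ 0) (ℤ.+-inverseʳ (value (stage n) i))
    stage-refines n (suc k) =
      let e∣ , e∣- = stage-refines n k
          e′∣ , e′∣- = proj₁ (proj₂ (refine (stage (k ℕ.+ n)) (k ℕ.+ n) (lem _)))
      in ℤ.∣-trans e∣ e′∣ , λ i → ≡.subst (+ modulus (stage n) ℤ.∣_)
           (telescope (value (stage n) i) (value (stage (k ℕ.+ n)) i) (value (stage (suc k ℕ.+ n)) i))
           (ℤ.∣m∣n⇒∣m+n (e∣- i) (ℤ.∣-trans e∣ (e′∣- i)))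
      where
      telescope : ∀ x y z → (y ℤ.- x) ℤ.+ (z ℤ.- y) ≡ z ℤ.- x
      telescope = solve-∀

    diagonal : ℕ → ℤ
    diagonal i = value (stage i) i

    -- The difference splits at the value `v` of stage `suc e`: `diagonal - v` is divisible by `e`
    -- from coordinate `suc e` on, and `v - m` is so off a finite list by consistency.
    solves : ∀ e m → Congruence e m → ∃[ w ] (λ i → diagonal i ℤ.- m i) Q.≈ + e Q.· w
    solves e m me = (λ i → w i ℤ.+ w′ i) , Q.trans {λ i → diagonal i ℤ.- m i}
        {λ i → + e ℤ.* (w i ℤ.+ w′ i)} {+ e Q.· (λ i → w i ℤ.+ w′ i)}
        (upTo (suc e) ++ is , λ i i∉ → ≡.trans
          (rearrange (diagonal i) (v i) (m i) (+ e) (w i) (w′ i))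
          (≡.cong₂ ℤ._+_ (ew-exact i (i∉ ∘ ∈-++⁺ˡ)) (≡0 i (i∉ ∘ ∈-++⁺ʳ (upTo (suc e))))))
        (*≈· ℕ ℤ^⟨ ℕ ⟩ (+ e) (λ i → w i ℤ.+ w′ i))
      where
      n = suc e
      v = value (stage n)
      e∣modulus : + e ℤ.∣ + modulus (stage n)
      e∣modulus = proj₂ (proj₂ (refine (stage e) e (lem _))) (m , me)

      consistency = consistent (weaken e∣modulus (proj₂ (proj₂ (stage n)))) me
      w′ = proj₁ consistency
      v-m≈ew′ = Q.trans {λ i → v i ℤ.- m i} {+ e Q.· w′} {λ i → + e ℤ.* w′ i} (proj₂ consistency)
        (Q.sym {λ i → + e ℤ.* w′ i} {+ e Q.· w′} (*≈· ℕ ℤ^⟨ ℕ ⟩ (+ e) w′))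
      is = proj₁ v-m≈ew′
      ≡0 = proj₂ v-m≈ew′

      e∣diagonal-v : ∀ i → n ℕ.≤ i → + e ℤ.∣ diagonal i ℤ.- v i
      e∣diagonal-v i n≤i = ≡.subst (λ k → + e ℤ.∣ value (stage k) i ℤ.- v i) (ℕ.m∸n+n≡m n≤i)
        (ℤ.∣-trans e∣modulus (proj₂ (stage-refines n (i ℕ.∸ n)) i))

      w : ℕ → ℤ
      w i with n ℕ.≤? i
      ... | yes n≤i = ℤ.quotient (e∣diagonal-v i n≤i)
      -- These coordinates belong to the exceptional list, so the value is arbitrary.
      ... | no  _   = + 0

      ew-exact : ∀ i → i ∉ upTo n → (diagonal i ℤ.- v i) ℤ.- + e ℤ.* w i ≡ + 0
      ew-exact i i∉ with n ℕ.≤? i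
      ... | no  n≰i = contradiction (∈-upTo⁺ (ℕ.≰⇒> n≰i)) i∉
      ... | yes n≤i with e∣diagonal-v i n≤i
      ...   | ℤ.divides q eq = ℤ.i≡j⇒i-j≡0 (≡.trans eq (ℤ.*-comm q (+ e)))

      rearrange : ∀ y v m e w w′ → (y ℤ.- m) ℤ.- e ℤ.* (w ℤ.+ w′) ≡
        ((y ℤ.- v) ℤ.- e ℤ.* w) ℤ.+ ((v ℤ.- m) ℤ.- e ℤ.* w′)
      rearrange = solve-∀

-- The p-adic integers

module PAdic (p : ℕ) (prime : Prime p) where

  private
    instance
      p≢0 : NonZero p
      p≢0 = prime⇒nonZero prime

    p^≢0 : ∀ n → NonZero (p ℕ.^ n)
    p^≢0 n = ℕ.m^n≢0 p n

    module Jₚ where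
      open AbelianGroup (J p) public
      open IntegerMultiples (J p) public
    module P = AbelianGroup (ℤ^ ℕ / powers p)

    p^_ : ℕ → ℤ
    p^ n = + (p ℕ.^ n)

    p^-+ : ∀ m n → p^ (m ℕ.+ n) ≡ p^ m ℤ.* p^ n
    p^-+ m n = ≡.trans (≡.cong +_ (ℕ.^-distribˡ-+-* p m n)) (ℤ.pos-* (p ℕ.^ m) (p ℕ.^ n))

    p^-suc : ∀ n → p^ suc n ≡ + p ℤ.* p^ n
    p^-suc n = ℤ.pos-* p (p ℕ.^ n)

    p^-∣ : ∀ {n} k → p^ n ℤ.∣ p^ (k ℕ.+ n)
    p^-∣ {n} k = ℤ.divides (p^ k) (p^-+ k n)

    ∣-cong : ∀ {d x y} → x ≡ y → d ℤ.∣ x → d ℤ.∣ y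
    ∣-cong {d} = ≡.subst (d ℤ.∣_)

    telescope : ∀ x y z → (x ℤ.- y) ℤ.+ (y ℤ.- z) ≡ x ℤ.- z
    telescope = solve-∀

    ∣-telescope : ∀ {d} x y z → d ℤ.∣ x ℤ.- y → d ℤ.∣ y ℤ.- z → d ℤ.∣ x ℤ.- z
    ∣-telescope x y z d∣ d∣′ = ∣-cong (telescope x y z) (ℤ.∣m∣n⇒∣m+n d∣ d∣′)

    ∣-swap : ∀ {d} x y → d ℤ.∣ x ℤ.- y → d ℤ.∣ y ℤ.- x
    ∣-swap x y d∣ = ∣-cong (negate x y) (ℤ.∣m⇒∣-m d∣)
      where
      negate : ∀ x y → ℤ.- (x ℤ.- y) ≡ y ℤ.- x
      negate = solve-∀

  infix 8 _at_
  _at_ : Jₚ.Carrier → ℕ → ℤ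
  x at n = proj₁ x n

  coherent-+ : ∀ (x : Jₚ.Carrier) n k → p^ n ℤ.∣ x at (k ℕ.+ n) ℤ.- x at n
  coherent-+ x n zero    = ℤ.divides (+ 0) (ℤ.+-inverseʳ (x at n))
  coherent-+ x n (suc k) = ∣-telescope (x at suc (k ℕ.+ n)) (x at (k ℕ.+ n)) (x at n)
    (ℤ.∣-trans (p^-∣ k) (proj₂ x (k ℕ.+ n))) (coherent-+ x n k)

  ·-at : ∀ i (x : Jₚ.Carrier) n → p^ n ℤ.∣ i ℤ.* x at n ℤ.- (i Jₚ.· x) at n
  ·-at i x = P.trans {λ n → i ℤ.* x at n} {i ℤP.· proj₁ x} {proj₁ (i Jₚ.· x)}
    (*≈· ℕ (powers p) i (proj₁ x))
    (P.sym {proj₁ (i Jₚ.· x)} {i ℤP.· proj₁ x} (·-homo (J p) (ℤ^ ℕ / powers p) forget i x))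
    where
    module ℤP = IntegerMultiples (ℤ^ ℕ / powers p)
    forget : GroupMorphisms.IsGroupHomomorphism Jₚ.rawGroup P.rawGroup proj₁
    forget = isGroupHomomorphism (J p) (ℤ^ ℕ / powers p) proj₁ (λ x≈y → x≈y)
      (λ x y → P.refl {proj₁ x P.∙ proj₁ y})

  ≈-·-intro : ∀ i (x z : Jₚ.Carrier) → (∀ n → p^ n ℤ.∣ z at n ℤ.- i ℤ.* x at n) → z Jₚ.≈ i Jₚ.· x
  ≈-·-intro i x z p^∣ n = ∣-telescope (z at n) (i ℤ.* x at n) ((i Jₚ.· x) at n) (p^∣ n) (·-at i x n)

  ≈-·-elim : ∀ i (x z : Jₚ.Carrier) → z Jₚ.≈ i Jₚ.· x → ∀ n → p^ n ℤ.∣ z at n ℤ.- i ℤ.* x at n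
  ≈-·-elim i x z z≈ n = ∣-telescope (z at n) ((i Jₚ.· x) at n) (i ℤ.* x at n) (z≈ n)
    (∣-swap (i ℤ.* x at n) ((i Jₚ.· x) at n) (·-at i x n))

  -- By coherence `p^ k` divides every coordinate from the `k`th on. Division by it costs `k` digits
  -- of precision, so the quotient at `n` is read off at `n + k`.
  p^-divisible : ∀ k (z : Jₚ.Carrier) → p^ k ℤ.∣ z at k → ∃[ w ] z Jₚ.≈ p^ k Jₚ.· w
  p^-divisible k z p^k∣z = w , ≈-·-intro (p^ k) w z λ n → ∣-cong
      (≡.cong (ℤ._-_ (z at n)) (shifted≡ n))
      (∣-swap (z at (n ℕ.+ k)) (z at n) (≡.subst (λ m → p^ n ℤ.∣ z at m ℤ.- z at n) (ℕ.+-comm k n)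
        (coherent-+ z n k)))
    where
    p^k∣shifted : ∀ n → p^ k ℤ.∣ z at (n ℕ.+ k)
    p^k∣shifted n = ∣-cong (cancel (z at (n ℕ.+ k)) (z at k)) (ℤ.∣m∣n⇒∣m+n (coherent-+ z k n) p^k∣z)
      where
      cancel : ∀ x y → (x ℤ.- y) ℤ.+ y ≡ x
      cancel = solve-∀

    q : ℕ → ℤ
    q n = ℤ.quotient (p^k∣shifted n)

    shifted≡ : ∀ n → z at (n ℕ.+ k) ≡ p^ k ℤ.* q n
    shifted≡ n = ≡.trans (ℤ._∣_.equality (p^k∣shifted n)) (ℤ.*-comm (q n) (p^ k))

    w : Jₚ.Carrier
    w = q , λ n → let ℤ.divides t eq = proj₂ z (n ℕ.+ k) in
      ℤ.divides t (ℤ.*-cancelˡ-≡ (p^ k) _ _ {{p^≢0 k}} (≡.trans (distrib (p^ k) (q (suc n)) (q n))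
        (≡.trans (≡.sym (≡.cong₂ ℤ._-_ (shifted≡ (suc n)) (shifted≡ n)))
        (≡.trans eq (≡.trans (≡.cong (t ℤ.*_) (p^-+ n k)) (rotate t (p^ n) (p^ k)))))))
      where
      distrib : ∀ c x y → c ℤ.* (x ℤ.- y) ≡ c ℤ.* x ℤ.- c ℤ.* y
      distrib = solve-∀
      rotate : ∀ t x y → t ℤ.* (x ℤ.* y) ≡ y ℤ.* (t ℤ.* x)
      rotate = solve-∀

  p^∣-coprime : ∀ n {α β u x} → α ℤ.* u ℤ.+ β ℤ.* p^ n ≡ + 1 → p^ n ℤ.∣ u ℤ.* x → p^ n ℤ.∣ x
  p^∣-coprime n {α} {β} {u} {x} bézout p^n∣ux = ∣-cong
    (≡.trans (regroup α β u (p^ n) x) (≡.trans (≡.cong (ℤ._* x) bézout) (ℤ.*-identityˡ x)))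
    (ℤ.∣m∣n⇒∣m+n (ℤ.∣n⇒∣m*n α p^n∣ux) (ℤ.∣n⇒∣m*n (β ℤ.* x) ℤ.∣-refl))
    where
    regroup : ∀ α β u q x → α ℤ.* (u ℤ.* x) ℤ.+ (β ℤ.* x) ℤ.* q ≡ (α ℤ.* u ℤ.+ β ℤ.* q) ℤ.* x
    regroup = solve-∀

  -- That `u` is prime to `p` is recorded by an inverse `α n` of `u` modulo each `p^ n`; together
  -- these make `u` act invertibly on the p-adic integers.
  record PrimePart (e : ℕ) : Set where
    field
      v u    : ℕ
      e≡     : + e ≡ p^ v ℤ.* + u
      α β    : ℕ → ℤ
      bézout : ∀ n → α n ℤ.* + u ℤ.+ β n ℤ.* p^ n ≡ + 1

  primePart : ∀ e .{{_ : NonZero e}} → PrimePart e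
  primePart e = ℕ.<-rec (λ e → .{{NonZero e}} → PrimePart e) build e
    where
    build : ∀ e → (∀ {k} → k ℕ.< e → .{{NonZero k}} → PrimePart k) → .{{NonZero e}} → PrimePart e
    build e rec with p ℕ.∣? e
    ... | yes (ℕ.divides q e≡qp) = record
          { v = suc v ; u = u ; α = α ; β = β ; bézout = bézout
          ; e≡ = ≡.trans (≡.cong +_ e≡qp) (≡.trans (ℤ.pos-* q p) (≡.trans (≡.cong (ℤ._* + p) e≡)
              (≡.trans (rotate (p^ v) (+ u) (+ p)) (≡.cong (ℤ._* + u) (≡.sym (p^-suc v)))))) }
      where
      instance
        q≢0 : NonZero q
        q≢0 = ℕ.≢-nonZero λ q≡0 → ℕ.≢-nonZero⁻¹ e (≡.trans e≡qp (≡.cong (ℕ._* p) q≡0))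
        p>1 = prime⇒nonTrivial prime
      open PrimePart (rec {q} (≡.subst (q ℕ.<_) (≡.sym e≡qp) (ℕ.m<m*n q p (ℕ.nonTrivial⇒n>1 p))))
      rotate : ∀ x u p → (x ℤ.* u) ℤ.* p ≡ (p ℤ.* x) ℤ.* u
      rotate = solve-∀
    ... | no p∤e with prime∣-or-coprime prime (+ e)
    ...   | inj₁ (q , e≡qp) = contradiction (ℤ.∣⇒∣ᵤ (ℤ.divides q e≡qp)) p∤e
    ...   | inj₂ (α , β , base) = record
          { v = 0 ; u = e ; e≡ = ≡.sym (ℤ.*-identityˡ (+ e))
          ; α = λ n → proj₁ (coefficients n) ; β = λ n → proj₁ (proj₂ (coefficients n))
          ; bézout = λ n → proj₂ (proj₂ (coefficients n)) }
      where
      -- The inductive step inserts `α′ e + β′ p^ n = 1` as a factor into the term `α p` of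
      -- `α p + β e = 1`.
      coefficients : ∀ n → ∃[ α ] ∃[ β ] α ℤ.* + e ℤ.+ β ℤ.* p^ n ≡ + 1
      coefficients zero    = + 0 , + 1 , ≡.refl
      coefficients (suc n) = let α′ , β′ , eq = coefficients n in
        α ℤ.* + p ℤ.* α′ ℤ.+ β , α ℤ.* β′ ,
        ≡.trans (≡.cong (λ z → (α ℤ.* + p ℤ.* α′ ℤ.+ β) ℤ.* + e ℤ.+ α ℤ.* β′ ℤ.* z) (p^-suc n))
        (≡.trans (expand α β (+ p) (+ e) α′ β′ (p^ n))
        (≡.trans (≡.cong (λ z → α ℤ.* + p ℤ.* z ℤ.+ β ℤ.* + e) eq)
        (≡.trans (≡.cong (ℤ._+ β ℤ.* + e) (ℤ.*-identityʳ (α ℤ.* + p))) base)))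
        where
        expand : ∀ α β p e α′ β′ q → (α ℤ.* p ℤ.* α′ ℤ.+ β) ℤ.* e ℤ.+ α ℤ.* β′ ℤ.* (p ℤ.* q) ≡
          α ℤ.* p ℤ.* (α′ ℤ.* e ℤ.+ β′ ℤ.* q) ℤ.+ β ℤ.* e
        expand = solve-∀

  -- The quotient is `α n · z` at coordinate `n`. It is coherent because its product with `u` is
  -- congruent to `z`, and `u` cancels modulo `p^ n`.
  coprime-divisible : ∀ (u : ℤ) (α β : ℕ → ℤ) → (∀ n → α n ℤ.* u ℤ.+ β n ℤ.* p^ n ≡ + 1) →
    ∀ z → ∃[ w ] z Jₚ.≈ u Jₚ.· w
  coprime-divisible u α β bézout z = w , ≈-·-intro u w z λ n → ∣-swap (u ℤ.* q n) (z at n) (uq≡z n)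
    where
    q : ℕ → ℤ
    q n = α n ℤ.* z at n

    uq≡z : ∀ n → p^ n ℤ.∣ u ℤ.* q n ℤ.- z at n
    uq≡z n = ℤ.divides (ℤ.- (β n ℤ.* z at n)) (≡.trans
      (≡.cong (λ y → u ℤ.* q n ℤ.- y) (≡.trans (≡.sym (ℤ.*-identityˡ (z at n)))
        (≡.cong (ℤ._* z at n) (≡.sym (bézout n)))))
      (expand u (α n) (β n) (p^ n) (z at n)))
      where
      expand : ∀ u α β q z → u ℤ.* (α ℤ.* z) ℤ.- (α ℤ.* u ℤ.+ β ℤ.* q) ℤ.* z ≡ ℤ.- (β ℤ.* z) ℤ.* q
      expand = solve-∀

    w : Jₚ.Carrier
    w = q , λ n → p^∣-coprime n {α n} {β n} {u} (bézout n) (∣-cong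
      (≡.sym (distrib u (q (suc n)) (q n)))
      (∣-telescope (u ℤ.* q (suc n)) (z at suc n) (u ℤ.* q n)
        (ℤ.∣-trans (p^-∣ {n} 1) (uq≡z (suc n)))
        (∣-telescope (z at suc n) (z at n) (u ℤ.* q n) (proj₂ z n)
          (∣-swap (u ℤ.* q n) (z at n) (uq≡z n)))))
      where
      distrib : ∀ c x y → c ℤ.* (x ℤ.- y) ≡ c ℤ.* x ℤ.- c ℤ.* y
      distrib = solve-∀

  -- Write `suc n = p^ v · u`. At coordinate `v + k` the factor `p^ v` can be cancelled with
  -- precision `p^ k` to spare, and coherence brings the result back to coordinate `k`.
  J-torsionFree : TorsionFree (J p)
  J-torsionFree n x nx≈ε k = ∣-cong (≡.sym (ℤ.+-identityʳ (x at k)))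
    (∣-cong (cancel (x at (v ℕ.+ k)) (x at k)) (ℤ.∣m∣n⇒∣m-n
      (p^∣-coprime k {α k} {β k} {+ u} (bézout k) (cancel-p^ (elim (v ℕ.+ k))))
      (coherent-+ x k v)))
    where
    open PrimePart (primePart (suc n))

    elim : ∀ m → p^ m ℤ.∣ + suc n ℤ.* x at m
    elim m = ∣-cong (negate (+ suc n ℤ.* x at m)) (ℤ.∣m⇒∣-m (≈-·-elim (+ suc n) x Jₚ.ε
      (Jₚ.sym {+ suc n Jₚ.· x} {Jₚ.ε} nx≈ε) m))
      where
      negate : ∀ y → ℤ.- (+ 0 ℤ.- y) ≡ y
      negate = solve-∀

    cancel : ∀ y x → y ℤ.- (y ℤ.- x) ≡ x
    cancel = solve-∀

    cancel-p^ : p^ (v ℕ.+ k) ℤ.∣ + suc n ℤ.* x at (v ℕ.+ k) → p^ k ℤ.∣ + u ℤ.* x at (v ℕ.+ k)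
    cancel-p^ (ℤ.divides q eq) = ℤ.divides q (ℤ.*-cancelˡ-≡ (p^ v) _ _ {{p^≢0 v}}
      (≡.trans (≡.sym (ℤ.*-assoc (p^ v) (+ u) (x at (v ℕ.+ k))))
      (≡.trans (≡.cong (ℤ._* x at (v ℕ.+ k)) (≡.sym e≡))
      (≡.trans eq (≡.trans (≡.cong (q ℤ.*_) (p^-+ v k)) (rotate q (p^ v) (p^ k)))))))
      where
      rotate : ∀ q x y → q ℤ.* (x ℤ.* y) ≡ x ℤ.* (q ℤ.* y)
      rotate = solve-∀

  1ₚ : Jₚ.Carrier
  1ₚ = (λ _ → + 1) , λ n → ℤ.divides (+ 0) ≡.refl

  -- Coordinate 1 gives the equation modulo `p`.
  1ₚ-indivisible : ∀ w → ¬ 1ₚ Jₚ.≈ + p Jₚ.· w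
  1ₚ-indivisible w 1≈pw = ¬prime[1] (≡.subst Prime (ℕ.∣1⇒≡1 (ℤ.∣⇒∣ᵤ p∣1)) prime)
    where
    cancel : ∀ p w → (+ 1 ℤ.- p ℤ.* w) ℤ.+ w ℤ.* p ≡ + 1
    cancel = solve-∀
    p∣1 : + p ℤ.∣ + 1
    p∣1 = ∣-cong (cancel (+ p) (w at 1)) (ℤ.∣m∣n⇒∣m+n
      (≡.subst (λ q → + q ℤ.∣ + 1 ℤ.- + p ℤ.* w at 1) (ℕ.*-identityʳ p) (≈-·-elim (+ p) w 1ₚ 1≈pw 1))
      (ℤ.divides (w at 1) ≡.refl))

  module _ (choice : ∀ {a b c d} → AxiomOfChoice a b c d) where
    open Classical choice

    -- Only the congruences modulo powers of p matter: the remaining factor of a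
    -- modulus acts invertibly on the p-adic integers.
    J-complete : Complete (J p)
    J-complete system = y , solves
      where
      open CongruenceSystem system

      next : ∀ k → Dec (∃[ m ] Congruence (p ℕ.^ k) m) → Jₚ.Carrier → Jₚ.Carrier
      next k (yes (m , _)) b = m
      -- Without a congruence modulo `p^ k` the previous approximant is kept.
      next k (no  _)       b = b

      approximant : ℕ → Jₚ.Carrier
      approximant zero    = Jₚ.ε
      approximant (suc k) = next (suc k) (lem _) (approximant k)

      approximant-solves : ∀ k {m} → Congruence (p ℕ.^ k) m → Congruence (p ℕ.^ k) (approximant k)
      approximant-solves zero    p = trivial
      approximant-solves (suc k) q with lem (∃[ m ] Congruence (p ℕ.^ suc k) m)
      ... | yes (_ , r) = r
      ... | no ∄m       = contradiction (_ , q) ∄m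

      approximant-converges : ∀ k → ∃[ w ]
        approximant (suc k) Jₚ.∙ approximant k Jₚ.⁻¹ Jₚ.≈ p^ k Jₚ.· w
      approximant-converges k with lem (∃[ m ] Congruence (p ℕ.^ suc k) m)
      -- The new congruence implies one modulo `p^ k`, where `approximant k` is therefore prescribed
      -- too; consistency compares the two values.
      ... | yes (_ , r) = let r′ = weaken (p^-∣ {k} 1) r in consistent r′ (approximant-solves k r′)
      ... | no  _       = Jₚ.ε , Jₚ.trans {x Jₚ.∙ x Jₚ.⁻¹} {Jₚ.ε} {p^ k Jₚ.· Jₚ.ε} (Jₚ.inverseʳ x)
              (Jₚ.sym {p^ k Jₚ.· Jₚ.ε} {Jₚ.ε} (Jₚ.·-ε (p^ k)))
        where x = approximant k

      approximant-≡ : ∀ k → p^ k ℤ.∣ approximant (suc k) at suc k ℤ.- approximant k at suc k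
      approximant-≡ k = let w , eq = approximant-converges k in ∣-cong
        (cancel (approximant (suc k) at suc k ℤ.- approximant k at suc k) (p^ k ℤ.* w at suc k))
        (ℤ.∣m∣n⇒∣m+n
          (ℤ.∣-trans (p^-∣ {k} 1)
            (≈-·-elim (p^ k) w (approximant (suc k) Jₚ.∙ approximant k Jₚ.⁻¹) eq (suc k)))
          (ℤ.∣m⇒∣m*n (w at suc k) ℤ.∣-refl))
        where
        cancel : ∀ x y → (x ℤ.- y) ℤ.+ y ≡ x
        cancel = solve-∀

      y : Jₚ.Carrier
      y = (λ k → approximant k at k) , λ k → ∣-telescope
        (approximant (suc k) at suc k) (approximant k at suc k) (approximant k at k)
        (approximant-≡ k) (proj₂ (approximant k) k)

      -- The two sequences coincide at coordinate `k`, which decides divisibility by `p^ k`.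
      y-approximates : ∀ k → ∃[ z ] y Jₚ.∙ approximant k Jₚ.⁻¹ Jₚ.≈ p^ k Jₚ.· z
      y-approximates k = p^-divisible k (y Jₚ.∙ approximant k Jₚ.⁻¹)
        (ℤ.divides (+ 0) (ℤ.+-inverseʳ (approximant k at k)))

      solves : ∀ e m → Congruence e m → ∃[ w ] y Jₚ.∙ m Jₚ.⁻¹ Jₚ.≈ + e Jₚ.· w
      solves e m me = w , chain
        where
        open PrimePart (primePart e {{nonZero me}})
        p^v∣e : p^ v ℤ.∣ + e
        p^v∣e = ℤ.divides (+ u) (≡.trans e≡ (ℤ.*-comm (p^ v) (+ u)))
        mv = weaken p^v∣e me
        x = approximant v
        z = proj₁ (y-approximates v)
        y-x = proj₂ (y-approximates v)
        z′ = proj₁ (consistent (approximant-solves v mv) mv)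
        x-m = proj₂ (consistent (approximant-solves v mv) mv)
        w = proj₁ (coprime-divisible (+ u) α β bézout (z Jₚ.∙ z′))
        z∙z′≈uw = proj₂ (coprime-divisible (+ u) α β bézout (z Jₚ.∙ z′))
        open SetoidReasoning Jₚ.setoid

        chain : y Jₚ.∙ m Jₚ.⁻¹ Jₚ.≈ + e Jₚ.· w
        chain = begin
          y Jₚ.∙ m Jₚ.⁻¹                              ≈⟨ telescope′ ⟩
          (y Jₚ.∙ x Jₚ.⁻¹) Jₚ.∙ (x Jₚ.∙ m Jₚ.⁻¹)      ≈⟨ ∙-cong′ ⟩
          p^ v Jₚ.· z Jₚ.∙ p^ v Jₚ.· z′               ≈⟨ Jₚ.·-distrib-∙ (p^ v) z z′ ⟨
          p^ v Jₚ.· (z Jₚ.∙ z′)                       ≈⟨ Jₚ.·-congˡ (p^ v) {z Jₚ.∙ z′} {+ u Jₚ.· w} z∙z′≈uw ⟩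
          p^ v Jₚ.· (+ u Jₚ.· w)                      ≈⟨ Jₚ.*-· (p^ v) (+ u) w ⟨
          (p^ v ℤ.* + u) Jₚ.· w                       ≈⟨ Jₚ.·-congʳ w (≡.sym e≡) ⟩
          + e Jₚ.· w                                  ∎
          where
          open Jₚ using (_⊕_; _⊝_)
          ∙-cong′ : (y Jₚ.∙ x Jₚ.⁻¹) Jₚ.∙ (x Jₚ.∙ m Jₚ.⁻¹) Jₚ.≈ p^ v Jₚ.· z Jₚ.∙ p^ v Jₚ.· z′
          ∙-cong′ = Jₚ.∙-cong {y Jₚ.∙ x Jₚ.⁻¹} {p^ v Jₚ.· z} {x Jₚ.∙ m Jₚ.⁻¹} {p^ v Jₚ.· z′} y-x x-m
          telescope′ : y Jₚ.∙ m Jₚ.⁻¹ Jₚ.≈ (y Jₚ.∙ x Jₚ.⁻¹) Jₚ.∙ (x Jₚ.∙ m Jₚ.⁻¹)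
          telescope′ = Jₚ.linear [] (y ∷ x ∷ m ∷ [])
            (λ y x m → y ⊝ m , (y ⊝ x) ⊕ (x ⊝ m)) (≡.refl , ≡.refl , ≡.refl , _)

-- A non-split extension by a group with torsion

private
  module ℚ⁺ where
    open AbelianGroup ℚ⁺ public
    open IntegerMultiples ℚ⁺ public
    open AbelianGroupProperties ℚ⁺ public

·-*ℚ : ∀ i q r → q ℚ.* (i ℚ⁺.· r) ≡ i ℚ⁺.· (q ℚ.* r)
·-*ℚ i q = ·-homo ℚ⁺ ℚ⁺ (isGroupHomomorphism ℚ⁺ ℚ⁺ (q ℚ.*_) (≡.cong (q ℚ.*_)) (ℚ.*-distribˡ-+ q)) i

n·1≥0 : ∀ n → 0ℚ ℚ.≤ + n ℚ⁺.· 1ℚ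
n·1≥0 zero    = ℚ.≤-refl
n·1≥0 (suc n) = ℚ.+-mono-≤ (ℚ.nonNegative⁻¹ 1ℚ) (n·1≥0 n)

[1+n]·1>0 : ∀ n → 0ℚ ℚ.< + suc n ℚ⁺.· 1ℚ
[1+n]·1>0 n = ℚ.+-mono-<-≤ (ℚ.positive⁻¹ 1ℚ) (n·1≥0 n)

i·1≡0⇒i≡0 : ∀ i → i ℚ⁺.· 1ℚ ≡ 0ℚ → i ≡ + 0
i·1≡0⇒i≡0 (+ zero)  eq = ≡.refl
i·1≡0⇒i≡0 (+ suc n) eq = contradiction (≡.sym eq) (ℚ.<⇒≢ ([1+n]·1>0 n))
i·1≡0⇒i≡0 -[1+ n ]  eq = contradiction
  (≡.sym (≡.trans (≡.sym (ℚ⁺.⁻¹-involutive (+ suc n ℚ⁺.· 1ℚ))) (≡.cong ℚ.-_ eq))) (ℚ.<⇒≢ ([1+n]·1>0 n))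

ℚ⁺-divisible : Divisible ℚ⁺
ℚ⁺-divisible n q = q ℚ.* ℚ.1/ n·1 , ≡.trans (≡.sym (·-*ℚ (+ suc n) q (ℚ.1/ n·1)))
  (≡.trans (≡.cong (q ℚ.*_) inverse) (ℚ.*-identityʳ q))
  where
  n·1 = + suc n ℚ⁺.· 1ℚ
  instance
    n·1≢0 : ℚ.NonZero n·1
    n·1≢0 = ℚ.pos⇒nonZero n·1 {{ℚ.positive ([1+n]·1>0 n)}}
  inverse : + suc n ℚ⁺.· (ℚ.1/ n·1) ≡ 1ℚ
  inverse = ≡.trans (ℚ⁺.·-congˡ (+ suc n) (≡.sym (ℚ.*-identityʳ (ℚ.1/ n·1))))
    (≡.trans (≡.sym (·-*ℚ (+ suc n) (ℚ.1/ n·1) 1ℚ)) (ℚ.*-inverseˡ n·1))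

quotient-divisible : (A : AbelianGroup a b) (N : Subgroup A p) → Divisible A → Divisible (A / N)
quotient-divisible A N divisible n x = let y , ny≈x = divisible n x in
  y , A/N.trans {+ suc n A/N.· y} {+ suc n A.· y} {x}
    (A/N.sym {+ suc n A.· y} {+ suc n A/N.· y} (·-homo A (A / N) (quotient-homo A N) (+ suc n) y))
    (GroupMorphisms.IsGroupHomomorphism.⟦⟧-cong (quotient-homo A N) ny≈x)
  where
  module A where
    open AbelianGroup A public
    open IntegerMultiples A public
  module A/N where
    open AbelianGroup (A / N) public
    open IntegerMultiples (A / N) public

integers : Subgroup ℚ⁺ 0ℓ
integers = record
  { member    = λ q → ∃[ k ] q ≡ k ℚ⁺.· 1ℚ
  ; resp      = λ { ≡.refl q∈ → q∈ }
  ; ε-closed  = + 0 , ≡.refl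
  ; ∙-closed  = λ (k , q≡) (l , r≡) → k ℤ.+ l ,
      ≡.trans (≡.cong₂ ℚ._+_ q≡ r≡) (≡.sym (ℚ⁺.+-· k l 1ℚ))
  ; ⁻¹-closed = λ (k , q≡) → ℤ.- k , ≡.trans (≡.cong ℚ.-_ q≡) (≡.sym (ℚ⁺.·-distrib-⁻¹ k 1ℚ))
  }

ℚ/ℤ : AbelianGroup 0ℓ 0ℓ
ℚ/ℤ = ℚ⁺ / integers

ℚ/ℤ-divisible : Divisible ℚ/ℤ
ℚ/ℤ-divisible = quotient-divisible ℚ⁺ integers ℚ⁺-divisible

-- Pull the extension ℤ → ℚ → ℚ/ℤ back along χ and push it out along ℤ → M, 1 ↦ m.
module PullbackPushout (G : AbelianGroup a b) (M : AbelianGroup c d)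
  (m : AbelianGroup.Carrier M) (χ : AbelianGroup.Carrier G → ℚ)
  (χ-homo : GroupMorphisms.IsGroupHomomorphism (AbelianGroup.rawGroup G) (AbelianGroup.rawGroup ℚ/ℤ) χ)
  where
  private
    module G where
      open AbelianGroup G public
      open IntegerMultiples G public
      open AbelianGroupProperties G public
    module M where
      open AbelianGroup M public
      open IntegerMultiples M public
      open AbelianGroupProperties M public
    module ℚ/ℤ where
      open AbelianGroup ℚ/ℤ public
    module χ = GroupMorphisms.IsGroupHomomorphism χ-homo

    ℚ×G = DirectProduct.abelianGroup ℚ⁺ G
    module ℚ×G = AbelianGroup ℚ×G

  pullback : Subgroup ℚ×G 0ℓ
  pullback = record
    { member    = λ (q , g) → q ℚ/ℤ.≈ χ g
    ; resp      = λ { {q , g} {_ , g′} (≡.refl , g≈g′) q≈χg →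
        ℚ/ℤ.trans {q} {χ g} {χ g′} q≈χg (χ.⟦⟧-cong g≈g′) }
    ; ε-closed  = ℚ/ℤ.sym {χ G.ε} {ℚ/ℤ.ε} χ.ε-homo
    ; ∙-closed  = λ { {q , g} {r , h} q≈ r≈ →
        ℚ/ℤ.trans {q ℚ.+ r} {χ g ℚ.+ χ h} {χ (g G.∙ h)}
          (ℚ/ℤ.∙-cong {q} {χ g} {r} {χ h} q≈ r≈) (ℚ/ℤ.sym {χ (g G.∙ h)} {χ g ℚ.+ χ h} (χ.homo g h)) }
    ; ⁻¹-closed = λ { {q , g} q≈ →
        ℚ/ℤ.trans {ℚ.- q} {ℚ.- χ g} {χ (g G.⁻¹)}
          (ℚ/ℤ.⁻¹-cong {q} {χ g} q≈) (ℚ/ℤ.sym {χ (g G.⁻¹)} {ℚ.- χ g} (χ.⁻¹-homo g)) }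
    }

  private
    M×P = DirectProduct.abelianGroup M ⌊ pullback ⌋
    module M×P where
      open AbelianGroup M×P public
      open IntegerMultiples M×P public

  -- Generated by `m` paired with `(-1 , ε)`, so that the quotient identifies `m` with the integer 1
  -- in the pullback.
  antidiagonal : Subgroup M×P (b ⊔ d)
  antidiagonal = record
    { member    = λ (x , (q , g) , _) → ∃[ k ] x M.≈ k M.· m × q ≡ k ℚ⁺.· (ℚ.- 1ℚ) × g G.≈ G.ε
    ; resp      = λ { (x≈ , q≡ , g≈) (k , p , q , r) →
        k , M.trans (M.sym x≈) p , ≡.trans (≡.sym q≡) q , G.trans (G.sym g≈) r }
    ; ε-closed  = + 0 , M.refl , ≡.refl , G.refl
    ; ∙-closed  = λ (k , p , q , r) (k′ , p′ , q′ , r′) → k ℤ.+ k′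
        , M.trans (M.∙-cong p p′) (M.sym (M.+-· k k′ m))
        , ≡.trans (≡.cong₂ ℚ._+_ q q′) (≡.sym (ℚ⁺.+-· k k′ (ℚ.- 1ℚ)))
        , G.trans (G.∙-cong r r′) (G.identityˡ G.ε)
    ; ⁻¹-closed = λ (k , p , q , r) → ℤ.- k
        , M.trans (M.⁻¹-cong p) (M.sym (M.·-distrib-⁻¹ k m))
        , ≡.trans (≡.cong ℚ.-_ q) (≡.sym (ℚ⁺.·-distrib-⁻¹ k (ℚ.- 1ℚ)))
        , G.trans (G.⁻¹-cong r) G.ε⁻¹≈ε
    }

  private
    E = M×P / antidiagonal
    module E where
      open AbelianGroup E public
      open IntegerMultiples E public

    ≈⇒∼ : ∀ {x y} → x M×P.≈ y → x E.≈ y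
    ≈⇒∼ {x} {y} = GroupMorphisms.IsGroupHomomorphism.⟦⟧-cong (quotient-homo M×P antidiagonal) {x} {y}

    ι : M.Carrier → E.Carrier
    ι x = x , AbelianGroup.ε ⌊ pullback ⌋

    π : E.Carrier → G.Carrier
    π (_ , (_ , g) , _) = g

    π-homo : GroupMorphisms.IsGroupHomomorphism E.rawGroup G.rawGroup π
    π-homo = isGroupHomomorphism E G π (λ (_ , _ , _ , g≈) → G.x∙y⁻¹≈ε⇒x≈y _ _ g≈) (λ _ _ → G.refl)

    module π = GroupMorphisms.IsGroupHomomorphism π-homo

    k·-1≡-k·1 : ∀ k → k ℚ⁺.· (ℚ.- 1ℚ) ≡ ℚ.- (k ℚ⁺.· 1ℚ)
    k·-1≡-k·1 k = ≡.trans (ℚ⁺.linear (k ∷ []) (1ℚ ∷ [])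
      (λ k x → k ℚ⁺.⊙ (ℚ⁺.⊖ x) , ℚ⁺.⊖ (k ℚ⁺.⊙ x)) (≡.refl , _)) ≡.refl

  extension : Extension G M
  extension = record
    { E = E
    ; ι = ι
    ; π = π
    ; ι-mono = record
      { isGroupHomomorphism = isGroupHomomorphism M E ι
          (λ {x} {y} x≈y → ≈⇒∼ {ι x} {ι y} (x≈y , ≡.refl , G.refl))
          (λ x y → ≈⇒∼ {ι (x M.∙ y)} {ι x E.∙ ι y} (M.refl , ≡.refl , G.sym (G.identityˡ G.ε)))
      -- The rational coordinate of the difference is 0, and 1 has infinite order in ℚ, so `k = 0`.
      ; injective = λ (k , x∙y⁻¹≈km , 0≡k·-1 , _) → M.x∙y⁻¹≈ε⇒x≈y _ _ (M.trans x∙y⁻¹≈km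
          (M.·-congʳ m (i·1≡0⇒i≡0 k (≡.trans (≡.sym (ℚ⁺.⁻¹-involutive (k ℚ⁺.· 1ℚ)))
            (≡.cong ℚ.-_ (≡.trans (≡.sym (k·-1≡-k·1 k)) (≡.sym 0≡k·-1)))))))
      }
    ; π-homo = π-homo
    ; π-surjective = λ g →
        let e = M.ε , (χ g , g) , ℚ/ℤ.refl {χ g} in e , λ {z} → π.⟦⟧-cong {z} {e}
    ; exact = λ { e@(x , (q , g) , q≈χg) → mk⇔
        -- When `g` vanishes, `q` is an integer `k`, which the pushout turns into `k · m`.
        (λ g≈ε → let k , q-0≡k = ℚ/ℤ.trans {q} {χ g} {0ℚ} q≈χg
                       (ℚ/ℤ.trans {χ g} {χ G.ε} {0ℚ} (χ.⟦⟧-cong g≈ε) χ.ε-homo) in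
          x M.∙ k M.· m , k
          , M.linear (k ∷ []) (x ∷ m ∷ []) (λ k x m → (x M.⊕ k M.⊙ m) M.⊝ x , k M.⊙ m)
              (≡.refl , ≡.refl , _)
          , ≡.trans (ℚ.+-identityˡ (ℚ.- q)) (≡.trans
              (≡.cong ℚ.-_ (≡.trans (≡.sym (ℚ.+-identityʳ q)) q-0≡k)) (≡.sym (k·-1≡-k·1 k)))
          , G.trans (G.∙-congˡ (G.⁻¹-cong g≈ε)) (G.inverseʳ G.ε))
        (λ (x , ιx≈e) → G.sym (π.⟦⟧-cong {ι x} {e} ιx≈e)) }
    }

  -- The multiple is `(1 , ε)` in the pullback, and the pushout identifies it with `ι m`; the
  -- coefficient of the antidiagonal element is 1.
  lift-multiple : ∀ n q g (q≈χg : q ℚ/ℤ.≈ χ g) → + n ℚ⁺.· q ≡ 1ℚ → + n G.· g G.≈ G.ε →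
    ι m E.≈ + n E.· (M.ε , (q , g) , q≈χg)
  lift-multiple n q g q≈χg nq≡1 ng≈ε =
    E.trans {ι m} {+ n M×P.· e} {+ n E.· e}
      (+ 1
      , M.trans (M.∙-congˡ (M.trans (M.⁻¹-cong (M.trans
          (·-homo M×P M proj₁-homo (+ n) e) (M.·-ε (+ n)))) M.ε⁻¹≈ε)) M.refl
      , ≡.cong (λ z → 0ℚ ℚ.+ ℚ.- z) (≡.trans (·-homo M×P ℚ⁺ q-homo (+ n) e) nq≡1)
      , G.trans (G.∙-congˡ (G.⁻¹-cong (G.trans (·-homo M×P G g-homo (+ n) e) ng≈ε))) (G.inverseʳ G.ε))
      (·-homo M×P E (quotient-homo M×P antidiagonal) (+ n) e)
    where
    e : M×P.Carrier
    e = M.ε , (q , g) , q≈χg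
    proj₁-homo = isGroupHomomorphism M×P M proj₁ proj₁ (λ _ _ → M.refl)
    q-homo = isGroupHomomorphism M×P ℚ⁺ (λ (_ , (q , _) , _) → q) (λ (_ , q≡ , _) → q≡) (λ _ _ → ≡.refl)
    g-homo = isGroupHomomorphism M×P G (λ (_ , (_ , g) , _) → g) (λ (_ , _ , g≈) → g≈) (λ _ _ → G.refl)

  isSplit⇒divisible : ∀ n q g → q ℚ/ℤ.≈ χ g → + n ℚ⁺.· q ≡ 1ℚ → + n G.· g G.≈ G.ε →
    _≅_ G M extension (split G M) → ∃[ w ] m M.≈ + n M.· w
  isSplit⇒divisible n q g q≈χg nq≡1 ng≈ε isSplit = r e , M.trans (M.sym (r-ι m))
    (M.trans (r.⟦⟧-cong {ι m} {+ n E.· e} (lift-multiple n q g q≈χg nq≡1 ng≈ε)) (·-homo E M r-homo (+ n) e))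
    where
    open Splitting G M extension
    e : E.Carrier
    e = M.ε , (q , g) , q≈χg
    r = proj₁ (isSplit⇒retraction isSplit)
    r-homo = proj₁ (proj₂ (isSplit⇒retraction isSplit))
    r-ι = proj₂ (proj₂ (isSplit⇒retraction isSplit))
    module r = GroupMorphisms.IsGroupHomomorphism r-homo

-- Vanishing of Ext and torsion

module _ (choice : ∀ {a b c d} → AxiomOfChoice a b c d) where
  open Classical choice

  module _ (G : AbelianGroup a b) where
    private
      module G where
        open AbelianGroup G public
        open IntegerMultiples G public
      module ℚ/ℤ where
        open AbelianGroup ℚ/ℤ public
        open IntegerMultiples ℚ/ℤ public

    open PartialHom choice G ℚ/ℤ
    open Subsets (G.Carrier × ℚ)

    -- g ↦ 1/p defines a homomorphism on the subgroup generated by g, as g has order p.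
    character : ∀ {p} → Prime p → ∀ g q → + p G.· g G.≈ G.ε → ¬ g G.≈ G.ε → + p ℚ⁺.· q ≡ 1ℚ →
      ∃[ χ ] GroupMorphisms.IsGroupHomomorphism G.rawGroup ℚ/ℤ.rawGroup χ × q ℚ/ℤ.≈ χ g
    character {p} p-prime g q pg≈ε g≉ε pq≡1 =
      (λ x → proj₁ (total x)) , total⇒hom isPartialHom total
      , functional {m = q} (cyclic⊆R (g , q) (⟪⟫-intro (+ 1 , G.sym (G.·-identity g)
          , ℚ/ℤ.sym {+ 1 ℚ/ℤ.· q} {q} (ℚ/ℤ.·-identity q)))) (proj₂ (total g))
      where
      -- For `k` prime to `p`, Bézout's identity would give `g ≈ ε`.
      order : ∀ k → k G.· g G.≈ G.ε → ∃[ j ] k ≡ j ℤ.* + p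
      order k kg≈ε with prime∣-or-coprime p-prime k
      ... | inj₁ p∣k = p∣k
      ... | inj₂ (α , β , bézout) = contradiction
              (G.trans (G.sym (G.·-identity g)) (G.trans (G.·-congʳ g (≡.sym bézout))
              (G.trans (G.+-· (α ℤ.* + p) (β ℤ.* k) g)
              (G.trans (G.∙-cong (multiple≈ε α (+ p) pg≈ε) (multiple≈ε β k kg≈ε)) (G.identityˡ G.ε)))))
              g≉ε
        where
        multiple≈ε : ∀ i j → j G.· g G.≈ G.ε → (i ℤ.* j) G.· g G.≈ G.ε
        multiple≈ε i j jg≈ε = G.trans (G.*-· i j g) (G.trans (G.·-congˡ i jg≈ε) (G.·-ε i))

      pq≈0 : + p ℚ/ℤ.· q ℚ/ℤ.≈ 0ℚ
      pq≈0 = ℚ/ℤ.trans {+ p ℚ/ℤ.· q} {+ p ℚ⁺.· q} {0ℚ}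
        (ℚ/ℤ.sym {+ p ℚ⁺.· q} {+ p ℚ/ℤ.· q} (·-homo ℚ⁺ ℚ/ℤ (quotient-homo ℚ⁺ integers) (+ p) q))
        (+ 1 , ≡.cong (ℚ._+ 0ℚ) pq≡1)

      cyclic : Subset
      cyclic (x , r) = ⟪ (∃[ k ] x G.≈ k G.· g × r ℚ/ℤ.≈ k ℚ/ℤ.· q) ⟫

      cyclic-isPartialHom : IsPartialHom cyclic
      cyclic-isPartialHom = record
        { resp = λ {_} {_} {r} {r′} x≈ r≈ x∈ → let k , p , s = ⟪⟫-elim x∈ in
            ⟪⟫-intro (k , G.trans (G.sym x≈) p
            , ℚ/ℤ.trans {r′} {r} {k ℚ/ℤ.· q} (ℚ/ℤ.sym {r} {r′} r≈) s)
        ; ε-closed = ⟪⟫-intro (+ 0 , G.refl , ℚ/ℤ.refl {0ℚ})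
        ; ∙-closed = λ {_} {_} {r} {r′} x∈ x∈′ → let
              k , p , s = ⟪⟫-elim x∈
              k′ , p′ , s′ = ⟪⟫-elim x∈′
            in ⟪⟫-intro (k ℤ.+ k′ , G.trans (G.∙-cong p p′) (G.sym (G.+-· k k′ g))
            , ℚ/ℤ.trans {r ℚ.+ r′} {k ℚ/ℤ.· q ℚ.+ k′ ℚ/ℤ.· q} {(k ℤ.+ k′) ℚ/ℤ.· q}
                (ℚ/ℤ.∙-cong {r} {k ℚ/ℤ.· q} {r′} {k′ ℚ/ℤ.· q} s s′)
                (ℚ/ℤ.sym {(k ℤ.+ k′) ℚ/ℤ.· q} {k ℚ/ℤ.· q ℚ.+ k′ ℚ/ℤ.· q} (ℚ/ℤ.+-· k k′ q)))
        ; ⁻¹-closed = λ {_} {r} x∈ → let k , p , s = ⟪⟫-elim x∈ in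
            ⟪⟫-intro (ℤ.- k , G.trans (G.⁻¹-cong p) (G.sym (G.·-distrib-⁻¹ k g))
            , ℚ/ℤ.trans {ℚ.- r} {ℚ.- (k ℚ/ℤ.· q)} {(ℤ.- k) ℚ/ℤ.· q}
                (ℚ/ℤ.⁻¹-cong {r} {k ℚ/ℤ.· q} s)
                (ℚ/ℤ.sym {(ℤ.- k) ℚ/ℤ.· q} {ℚ.- (k ℚ/ℤ.· q)} (ℚ/ℤ.·-distrib-⁻¹ k q)))
        ; preserves-multiples = λ
          { (suc n) {_} {r} f x∈ x≈ → let w , nw≈r = ℚ/ℤ-divisible n r in
              w , ℚ/ℤ.sym {+ suc n ℚ/ℤ.· w} {r} nw≈r
          -- Here `k = j p`, and `k · q = j · (p · q)` vanishes in ℚ/ℤ because `p · q = 1`.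
          ; zero {_} {r} f x∈ x≈ε → let
                k , p₁ , s = ⟪⟫-elim x∈
                j , k≡jp = order k (G.trans (G.sym p₁) x≈ε)
              in 0ℚ , ℚ/ℤ.trans {r} {k ℚ/ℤ.· q} {0ℚ} s
                (ℚ/ℤ.trans {k ℚ/ℤ.· q} {(j ℤ.* + p) ℚ/ℤ.· q} {0ℚ} (ℚ/ℤ.·-congʳ q k≡jp)
                (ℚ/ℤ.trans {(j ℤ.* + p) ℚ/ℤ.· q} {j ℚ/ℤ.· (+ p ℚ/ℤ.· q)} {0ℚ} (ℚ/ℤ.*-· j (+ p) q)
                (ℚ/ℤ.trans {j ℚ/ℤ.· (+ p ℚ/ℤ.· q)} {j ℚ/ℤ.· 0ℚ} {0ℚ}
                  (ℚ/ℤ.·-congˡ j {+ p ℚ/ℤ.· q} {0ℚ} pq≈0) (ℚ/ℤ.·-ε j))))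
          }
        }

      R⊇cyclic = extendToMaximal cyclic-isPartialHom
      cyclic⊆R = proj₁ (proj₂ R⊇cyclic)
      open IsMaximal (proj₂ (proj₂ R⊇cyclic))
      total = divisible⇒total choice G ℚ/ℤ ℚ/ℤ-divisible (proj₂ (proj₂ R⊇cyclic))

    module _ (M : AbelianGroup c d) where
      open AbelianGroup M
      open IntegerMultiples M

      ⊥⇒p-torsionFree : ∀ {p} → Prime p → (m : Carrier) → (∀ w → ¬ m ≈ + p · w) → (⊥ M) G →
        ∀ g → + p G.· g G.≈ G.ε → g G.≈ G.ε
      ⊥⇒p-torsionFree {zero}  p-prime m m∤ G∈⊥M g pg≈ε =
        contradiction (prime⇒nonZero p-prime) λ ()
      ⊥⇒p-torsionFree {suc n} p-prime m m∤ G∈⊥M g pg≈ε = ¬¬-elim λ g≉ε → let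
          q , pq≡1 = ℚ⁺-divisible n 1ℚ
          χ , χ-homo , q≈χg = character p-prime g q pg≈ε g≉ε pq≡1
          w , m≈pw = PullbackPushout.isSplit⇒divisible G M m χ χ-homo (suc n) q g q≈χg pq≡1 pg≈ε
            (G∈⊥M (PullbackPushout.extension G M m χ χ-homo))
        in m∤ w m≈pw

    -- The prime factors of `suc n` are cancelled one at a time.
    p-torsionFree⇒torsionFree :
      (∀ {p} → Prime p → ∀ g → + p G.· g G.≈ G.ε → g G.≈ G.ε) → TorsionFree G
    p-torsionFree⇒torsionFree p-torsionFree n g ng≈ε = product-torsionFree factors factorsPrime
      (G.trans (G.·-congʳ g (≡.cong +_ (≡.sym isFactorisation))) ng≈ε)
      where
      open PrimeFactorisation (factorise (suc n))
      product-torsionFree : ∀ ps → All Prime ps → + product ps G.· g G.≈ G.ε → g G.≈ G.ε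
      product-torsionFree []       []         eq = G.trans (G.sym (G.·-identity g)) eq
      product-torsionFree (p ∷ ps) (p-prime ∷ primes) eq = product-torsionFree ps primes
        (p-torsionFree p-prime _ (G.trans (G.sym (G.*-· (+ p) (+ product ps) g))
          (G.trans (G.·-congʳ g (≡.sym (ℤ.pos-* p (product ps)))) eq)))

theorem3p1 : (∀ {a b c d} → AxiomOfChoice a b c d) →
    ∀ {a b k} →
    (_≐_ {A = AbelianGroup a b} (⊥ ℚ⁺) U)
    × (_≐_ {A = AbelianGroup a b} (⊥ (ℤ^ ℕ / ℤ^⟨ ℕ ⟩)) (⋂ (∃ Prime) (λ p → ⊥ (J (proj₁ p)))))
    × (∀ (κ : Set k) → _≐_ {A = AbelianGroup a b} (⊥ (ℤ^ κ / B^<∞ κ)) (⊥ ℚ⁺))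
theorem3p1 choice =
  ((λ _ → _) , λ {G} _ → divisible⇒⊥ choice ℚ⁺ ℚ⁺-divisible G)
  -- The constant sequence 1 is divisible by no prime, so this single group excludes torsion of
  -- every prime order.
  , ((λ {G} G∈⊥ (p , p-prime) → torsionFree⇒⊥ choice (J p)
        (PAdic.J-torsionFree p p-prime) (PAdic.J-complete p p-prime choice) G
        (p-torsionFree⇒torsionFree choice G λ {q} q-prime → ⊥⇒p-torsionFree choice G ℤ^ω/ℤ^⟨ω⟩ q-prime
          (λ _ → + 1) (λ w 1≈qw → ¬prime[1] (≡.subst Prime (1-indivisible q w 1≈qw) q-prime)) G∈⊥))
    -- Each prime `p` is handled by its own `J p`, in which 1 is not divisible by `p`.
    , (λ {G} G∈⊥ → torsionFree⇒⊥ choice ℤ^ω/ℤ^⟨ω⟩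
        ℤ^ω/ℤ^⟨ω⟩-torsionFree (ℤ^ω/ℤ^⟨ω⟩-complete choice) G
        (p-torsionFree⇒torsionFree choice G λ {p} p-prime → ⊥⇒p-torsionFree choice G (J p) p-prime
          (PAdic.1ₚ p p-prime) (PAdic.1ₚ-indivisible p p-prime) (G∈⊥ (p , p-prime)))))
  , λ κ → (λ {G} _ → divisible⇒⊥ choice ℚ⁺ ℚ⁺-divisible G)
        , (λ {G} _ → divisible⇒⊥ choice (ℤ^ κ / B^<∞ κ) (ℤ^κ/B-divisible κ) G)
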